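{- Let $\Gamma$ be a context, $M,N$ objects, $A,B$ types and $\tau$ a simple type. (1) If $\Gamma^-\vdash M\Leftrightarrow N:A^-$ and $\Gamma\vdash M:A$ and $\Gamma\vdash N:A$, then $\Gamma\vdash M=N:A$. (2) If $\Gamma^-\vdash M\leftrightarrow N:\tau$ and $\Gamma\vdash M:A$ and $\Gamma\vdash N:B$, then $\Gamma\vdash A=B:\mathrm{type}$ and $\Gamma\vdash M=N:A$ and $A^-=\tau=B^-$.
   Context: **Syntax of $\lambda^{\Pi N}$.** Fix countable, pairwise disjoint sets of variables $x,y$, names $\mathsf a,\mathsf b$, object constants $c$, type constants $a$, and name-type constants $\alpha,\beta$. Kinds: $K::=\mathrm{type}\mid\Pi x{:}A.K$. Types (type families): $A,B::=a\mid A\,M\mid\Pi x{:}A.B\mid\alpha\mid\mathrm{New}\,\mathsf a{:}\alpha.B$. Objects: $M,N::=c\mid x\mid\lambda x{:}A.M\mid M\,N\mid\mathsf a\mid\langle\mathsf a{:}\alpha\rangle M\mid M@\mathsf a$. Signatures: $\Sigma::=\cdot\mid\Sigma,c{:}A\mid\Sigma,a{:}K\mid\Sigma,\alpha{:}\mathrm{name}$. Contexts: $\Gamma::=\cdot\mid\Gamma,x{:}A\mid\Gamma\#\mathsf a{:}\alpha$. $\Pi,\lambda$ bind $x$; $\mathrm{New}$ and $\langle\mathsf a{:}\alpha\rangle$ bind $\mathsf a$; expressions are identified up to renaming of bound variables and names, and $[M/x]$, $[\mathsf b/\mathsf a]$ are capture-avoiding. Items declared in a signature or context are distinct. All judgments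 except signature formation are implicitly parametrized by a signature $\Sigma$; signatures and contexts are implicitly well-formed and bound variables/names implicitly fresh. **Restriction** $\Gamma\vdash\mathsf a{:}\alpha\backslash\Gamma'$ (inductively): $\Gamma\#\mathsf a{:}\alpha\vdash\mathsf a{:}\alpha\backslash\Gamma$; if $\Gamma\vdash\mathsf a{:}\alpha\backslash\Gamma'$ then $\Gamma\#\mathsf b{:}\beta\vdash\mathsf a{:}\alpha\backslash\Gamma'\#\mathsf b{:}\beta$ and $\Gamma,x{:}A\vdash\mathsf a{:}\alpha\backslash\Gamma'$. **Formation.** Signatures: $\cdot$ is well-formed; a well-formed $\Sigma$ may be extended by $a{:}K$ if $\cdot\vdash K:\mathrm{kind}$, by $c{:}A$ if $\cdot\vdash A:\mathrm{type}$, by $\alpha{:}\mathrm{name}$ always. Contexts: $\cdot$ is well-formed; a well-formed $\Gamma$ may be extended by $x{:}A$ if $\Gamma\vdash A:\mathrm{type}$, by $\#\mathsf a{:}\alpha$ if $\alpha{:}\mathrm{name}\in\Sigma$. Kinds: $\Gamma\vdash\mathrm{type}:\mathrm{kind}$; if $\Gamma\vdash A:\mathrm{type}$ and $\Gamma,x{:}A\vdash K:\mathrm{kind}$ then $\Gamma\vdash\Pi x{:}A.K:\mathrm{kind}$. Types: $\Gamma\vdash a:K$ if $a{:}K\in\Sigma$; $\Gamma\vdash A\,M:K[M/x]$ if $\Gamma\vdash A:\Pi x{:}B.K$ and $\Gamma\vdash M:B$; $\Gamma\vdash\Pi x{:}A.B:\mathrm{type}$ if $\Gamma\vdash A:\mathrm{type}$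 and $\Gamma,x{:}A\vdash B:\mathrm{type}$; $\Gamma\vdash\alpha:\mathrm{type}$ if $\alpha{:}\mathrm{name}\in\Sigma$; $\Gamma\vdash\mathrm{New}\,\mathsf a{:}\alpha.B:\mathrm{type}$ if $\alpha{:}\mathrm{name}\in\Sigma$ and $\Gamma\#\mathsf a{:}\alpha\vdash B:\mathrm{type}$; conversion: $\Gamma\vdash A:K'$ and $\Gamma\vdash K=K':\mathrm{kind}$ give $\Gamma\vdash A:K$. Objects: $\Gamma\vdash c:A$ if $c{:}A\in\Sigma$; $\Gamma\vdash x:A$ if $x{:}A\in\Gamma$; $\Gamma\vdash\mathsf a:\alpha$ if $\mathsf a{:}\alpha\in\Gamma$; $\Gamma\vdash\lambda x{:}A.M:\Pi x{:}A.B$ if $\Gamma\vdash A:\mathrm{type}$ and $\Gamma,x{:}A\vdash M:B$; $\Gamma\vdash M\,N:B[N/x]$ if $\Gamma\vdash M:\Pi x{:}A.B$ and $\Gamma\vdash N:A$; $\Gamma\vdash\langle\mathsf a{:}\alpha\rangle M:\mathrm{New}\,\mathsf a{:}\alpha.B$ if $\alpha{:}\mathrm{name}\in\Sigma$ and $\Gamma\#\mathsf a{:}\alpha\vdash M:B$; $\Gamma\vdash M@\mathsf a:B$ if $\Gamma\vdash\mathsf a{:}\alpha\backslash\Gamma'$ and $\Gamma'\vdash M:\mathrm{New}\,\mathsf a{:}\alpha.B$; conversion: $\Gamma\vdash M:A$ and $\Gamma\vdash A=B:\mathrm{type}$ give $\Gamma\vdash M:B$. **Definitional equality.** Standard LF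 rules. At each of the three levels: symmetry and transitivity; at the object (type) level conversion along an equal type (kind). Kinds: $\mathrm{type}=\mathrm{type}$; $\Pi x{:}A.K=\Pi x{:}B.L$ if $\Gamma\vdash A:\mathrm{type}$, $\Gamma\vdash A=B:\mathrm{type}$ and $\Gamma,x{:}A\vdash K=L:\mathrm{kind}$. Types: $a=a:K$ if $a{:}K\in\Sigma$; $A\,M=B\,N:K[M/x]$ if $A=B:\Pi x{:}C.K$ and $M=N:C$; $\Pi x{:}A_1.A_2=\Pi x{:}B_1.B_2:\mathrm{type}$ if $\Gamma\vdash A_1:\mathrm{type}$, $A_1=B_1:\mathrm{type}$ and $\Gamma,x{:}A_1\vdash A_2=B_2:\mathrm{type}$. Objects: $x=x:A$ and $c=c:A$ for declared $x{:}A$, $c{:}A$; $M_1M_2=N_1N_2:B[M_2/x]$ if $M_1=N_1:\Pi x{:}A.B$ and $M_2=N_2:A$; $\lambda x{:}A'.M=\lambda x{:}A''.N:\Pi x{:}A.B$ if $A'=A:\mathrm{type}$, $A''=A:\mathrm{type}$ and $\Gamma,x{:}A\vdash M=N:B$; $(\lambda x{:}A.M_2)M_1=N_2[N_1/x]:B[M_1/x]$ if $\Gamma\vdash A:\mathrm{type}$, $\Gamma,x{:}A\vdash M_2=N_2:B$ and $M_1=N_1:A$; $M=N:\Pi x{:}A.B$ if $\Gamma\vdash A:\mathrm{type}$, $\Gamma\vdash M:\Pi x{:}A.B$, $\Gamma\vdash N:\Pi x{:}A.B$ and $\Gamma,x{:}A\vdash M\,x=N\,x:B$. Additional rules: $A_1=A_2:\Pi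 x{:}B.K$ if $\Gamma,x{:}B\vdash A_1\,x=A_2\,x:K$; $\alpha=\alpha:\mathrm{type}$ if $\alpha{:}\mathrm{name}\in\Sigma$; $\mathrm{New}\,\mathsf a{:}\alpha.A=\mathrm{New}\,\mathsf a{:}\alpha.B:\mathrm{type}$ if $\Gamma\#\mathsf a{:}\alpha\vdash A=B:\mathrm{type}$; $\mathsf a=\mathsf a:\alpha$ if $\mathsf a{:}\alpha\in\Gamma$; $\langle\mathsf a{:}\alpha\rangle M=\langle\mathsf a{:}\alpha\rangle N:\mathrm{New}\,\mathsf a{:}\alpha.A$ if $\Gamma\#\mathsf a{:}\alpha\vdash M=N:A$; $M@\mathsf b=N@\mathsf b:A[\mathsf b/\mathsf a]$ if $\Gamma\vdash\mathsf b{:}\alpha\backslash\Gamma'$ and $\Gamma'\vdash M=N:\mathrm{New}\,\mathsf a{:}\alpha.A$; $(\langle\mathsf a{:}\alpha\rangle M)@\mathsf b=N[\mathsf b/\mathsf a]:A[\mathsf b/\mathsf a]$ if $\Gamma\vdash\mathsf b{:}\alpha\backslash\Gamma'$ and $\Gamma'\#\mathsf a{:}\alpha\vdash M=N:A$; $M=N:\mathrm{New}\,\mathsf a{:}\alpha.A$ if $\Gamma\#\mathsf a{:}\alpha\vdash M@\mathsf a=N@\mathsf a:A$. **Erasure.** Simple types $\tau::=a^-\mid\tau\to\tau'\mid\langle\alpha\rangle\tau\mid\alpha$. Erasure: type constant $a\mapsto a^-$, $(A\,M)^-=A^-$, $(\Pi x{:}A.B)^-=A^-\to B^-$, $(\alpha)^-=\alpha$,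 $(\mathrm{New}\,\mathsf a{:}\alpha.A)^-=\langle\alpha\rangle A^-$. Simple contexts $\Delta::=\cdot\mid\Delta,x{:}\tau\mid\Delta\#\mathsf a{:}\alpha$; $\Gamma^-$ erases each type in $\Gamma$. Restriction $\Delta\vdash\mathsf a{:}\alpha\backslash\Delta'$ is defined by the same three rules for simple contexts. **Weak head reduction** $M\to_{wh}M'$: $(\lambda x{:}A.M)N\to_{wh}M[N/x]$; $(\langle\mathsf a{:}\alpha\rangle M)@\mathsf b\to_{wh}M[\mathsf b/\mathsf a]$; if $M\to_{wh}M'$ then $M\,N\to_{wh}M'\,N$ and $M@\mathsf a\to_{wh}M'@\mathsf a$. **Algorithmic equivalence** $\Delta\vdash M\Leftrightarrow N:\tau$ and **structural equivalence** $\Delta\vdash M\leftrightarrow N:\tau$ (mutually inductive). For $\delta$ of the form $a^-$ or $\alpha$: $M\Leftrightarrow N:\delta$ if $M\to_{wh}M'$ and $M'\Leftrightarrow N:\delta$; or $N\to_{wh}N'$ and $M\Leftrightarrow N':\delta$; or $M\leftrightarrow N:\delta$. $\Delta\vdash M\Leftrightarrow N:\tau_1\to\tau_2$ if $\Delta,x{:}\tau_1\vdash M\,x\Leftrightarrow N\,x:\tau_2$ ($x$ fresh); $\Delta\vdash M\Leftrightarrow N:\langle\alpha\rangle\tau$ if $\Delta\#\mathsf a{:}\alpha\vdash M@\mathsf a\Leftrightarrow N@\mathsf a:\tau$ ($\mathsf a$ fresh). $\Delta\vdash x\leftrightarrow x:\tau$ if $x{:}\tau\in\Delta$; $c\leftrightarrow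 c:A^-$ if $c{:}A\in\Sigma$; $\mathsf a\leftrightarrow\mathsf a:\alpha$ if $\mathsf a{:}\alpha\in\Delta$; $M_1M_2\leftrightarrow N_1N_2:\tau_2$ if $\Delta\vdash M_1\leftrightarrow N_1:\tau_1\to\tau_2$ and $\Delta\vdash M_2\Leftrightarrow N_2:\tau_1$; $M@\mathsf a\leftrightarrow N@\mathsf a:\tau$ if $\Delta\vdash\mathsf a{:}\alpha\backslash\Delta'$ and $\Delta'\vdash M\leftrightarrow N:\langle\alpha\rangle\tau$. -}

module Defs where

open import Data.Fin.Base using (Fin; zero; suc; lift)
open import Data.List.Base using (List; []; _∷_)
open import Data.List.Membership.Propositional using (_∈_; _∉_)
open import Data.Nat.Base using (ℕ; zero; suc)
import Data.Vec.Functional as Vector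
open import Function.Base using (id; _∘_)

infixl 9 _·_ _＠_
infixl 8 _[_] _[_]ᵗ _[_]ᵏ _[_]ⁿ _[_]ⁿᵗ
infixl 5 _▸_ _#_
infixr 7 _⇒_ ⟨_⟩ˢ_
infix  4 _⊢_∶_╲_ _∋_∶_ _∋ˢ_∶_ _∋ⁿ_∶_ _→wh_

private variable
  n m n' m' : ℕ

------------------------------------------------------------------------
-- Syntax

ObjConst TyConst NameTy : Set
ObjConst = ℕ
TyConst  = ℕ
NameTy   = ℕ

-- Expressions are well-scoped de Bruijn terms with two independent index
-- spaces: an element of Obj n m has its free variables in Fin n and its free
-- names in Fin m.  Π and ƛ bind the variable zero, New and ⟨_⟩ bind the name
-- zero, so propositional equality is equality up to renaming of bound
-- variables and names.

mutual
  data Ty (n m : ℕ) : Set where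
    con  : TyConst → Ty n m
    _·_  : Ty n m → Obj n m → Ty n m
    Π    : Ty n m → Ty (suc n) m → Ty n m
    name : NameTy → Ty n m
    New  : NameTy → Ty n (suc m) → Ty n m

  data Obj (n m : ℕ) : Set where
    con  : ObjConst → Obj n m
    var  : Fin n → Obj n m
    ƛ    : Ty n m → Obj (suc n) m → Obj n m
    _·_  : Obj n m → Obj n m → Obj n m
    name : Fin m → Obj n m
    ⟨_⟩_ : NameTy → Obj n (suc m) → Obj n m
    _＠_  : Obj n m → Fin m → Obj n m

data Kind (n m : ℕ) : Set where
  type : Kind n m
  Π    : Ty n m → Kind (suc n) m → Kind n m

-- Constants are declared with closed classifiers; the most recent
-- declaration is at the head of the list.

data Decl : Set where
  _∶ᵒ_  : ObjConst → Ty 0 0 → Decl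
  _∶ᵗ_  : TyConst → Kind 0 0 → Decl
  _∶name : NameTy → Decl

Sig : Set
Sig = List Decl

-- Contexts, generically in the classifiers of variables, so that dependent
-- and simple contexts share one definition of restriction.

data Cx (T : ℕ → ℕ → Set) : ℕ → ℕ → Set where
  ∙   : Cx T 0 0
  _▸_ : Cx T n m → T n m → Cx T (suc n) m
  _#_ : Cx T n m → NameTy → Cx T n (suc m)

Ctx : ℕ → ℕ → Set
Ctx = Cx Ty

------------------------------------------------------------------------
-- Renaming and substitution

record Ren (n m n' m' : ℕ) : Set where
  constructor ren
  field
    onVar  : Fin n → Fin n'
    onName : Fin m → Fin m'

liftᵛ : Ren n m n' m' → Ren (suc n) m (suc n') m'
liftᵛ (ren f g) = ren (lift 1 f) g

liftⁿ : Ren n m n' m' → Ren n (suc m) n' (suc m')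
liftⁿ (ren f g) = ren f (lift 1 g)

mutual
  renTy : Ren n m n' m' → Ty n m → Ty n' m'
  renTy ρ (con a)   = con a
  renTy ρ (A · M)   = renTy ρ A · renObj ρ M
  renTy ρ (Π A B)   = Π (renTy ρ A) (renTy (liftᵛ ρ) B)
  renTy ρ (name α)  = name α
  renTy ρ (New α B) = New α (renTy (liftⁿ ρ) B)

  renObj : Ren n m n' m' → Obj n m → Obj n' m'
  renObj ρ (con c)   = con c
  renObj ρ (var x)   = var (Ren.onVar ρ x)
  renObj ρ (ƛ A M)   = ƛ (renTy ρ A) (renObj (liftᵛ ρ) M)
  renObj ρ (M · N)   = renObj ρ M · renObj ρ N
  renObj ρ (name a)  = name (Ren.onName ρ a)
  renObj ρ (⟨ α ⟩ M) = ⟨ α ⟩ renObj (liftⁿ ρ) M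
  renObj ρ (M ＠ a)   = renObj ρ M ＠ Ren.onName ρ a

renKind : Ren n m n' m' → Kind n m → Kind n' m'
renKind ρ type    = type
renKind ρ (Π A K) = Π (renTy ρ A) (renKind (liftᵛ ρ) K)

wkᵛ : Ren n m (suc n) m
wkᵛ = ren suc id

wkⁿ : Ren n m n (suc m)
wkⁿ = ren id suc

fromClosed : Ren 0 0 n m
fromClosed = ren (λ ()) (λ ())

-- Names are only ever replaced by names.

record Sub (n m n' m' : ℕ) : Set where
  constructor sub
  field
    onVar  : Fin n → Obj n' m'
    onName : Fin m → Fin m'

liftˢᵛ : Sub n m n' m' → Sub (suc n) m (suc n') m'
liftˢᵛ (sub f g) = sub (var zero Vector.∷ (renObj wkᵛ ∘ f)) g

liftˢⁿ : Sub n m n' m' → Sub n (suc m) n' (suc m')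
liftˢⁿ (sub f g) = sub (renObj wkⁿ ∘ f) (lift 1 g)

mutual
  subTy : Sub n m n' m' → Ty n m → Ty n' m'
  subTy σ (con a)   = con a
  subTy σ (A · M)   = subTy σ A · subObj σ M
  subTy σ (Π A B)   = Π (subTy σ A) (subTy (liftˢᵛ σ) B)
  subTy σ (name α)  = name α
  subTy σ (New α B) = New α (subTy (liftˢⁿ σ) B)

  subObj : Sub n m n' m' → Obj n m → Obj n' m'
  subObj σ (con c)   = con c
  subObj σ (var x)   = Sub.onVar σ x
  subObj σ (ƛ A M)   = ƛ (subTy σ A) (subObj (liftˢᵛ σ) M)
  subObj σ (M · N)   = subObj σ M · subObj σ N
  subObj σ (name a)  = name (Sub.onName σ a)
  subObj σ (⟨ α ⟩ M) = ⟨ α ⟩ subObj (liftˢⁿ σ) M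
  subObj σ (M ＠ a)   = subObj σ M ＠ Sub.onName σ a

subKind : Sub n m n' m' → Kind n m → Kind n' m'
subKind σ type    = type
subKind σ (Π A K) = Π (subTy σ A) (subKind (liftˢᵛ σ) K)

instVar : Obj n m → Sub (suc n) m n m
instVar M = sub (M Vector.∷ var) id

instName : Fin m → Ren n (suc m) n m
instName b = ren id (b Vector.∷ id)

_[_] : Obj (suc n) m → Obj n m → Obj n m
M [ N ] = subObj (instVar N) M

_[_]ᵗ : Ty (suc n) m → Obj n m → Ty n m
A [ N ]ᵗ = subTy (instVar N) A

_[_]ᵏ : Kind (suc n) m → Obj n m → Kind n m
K [ N ]ᵏ = subKind (instVar N) K

_[_]ⁿ : Obj n (suc m) → Fin m → Obj n m
M [ b ]ⁿ = renObj (instName b) M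

_[_]ⁿᵗ : Ty n (suc m) → Fin m → Ty n m
A [ b ]ⁿᵗ = renTy (instName b) A

------------------------------------------------------------------------
-- Restriction and membership

-- Γ ⊢ a ∶ α ╲ Γ' : removing from Γ the name a, and every variable declared
-- after a, leaves Γ'.

data _⊢_∶_╲_ {T : ℕ → ℕ → Set} :
     Cx T n m → Fin m → NameTy → Cx T n' m' → Set where
  here  : ∀ {Γ : Cx T n m} {α} →
          Γ # α ⊢ zero ∶ α ╲ Γ
  skipⁿ : ∀ {Γ : Cx T n m} {Γ' : Cx T n' m'} {a α β} →
          Γ ⊢ a ∶ α ╲ Γ' →
          Γ # β ⊢ suc a ∶ α ╲ Γ' # β
  skipᵛ : ∀ {Γ : Cx T n m} {Γ' : Cx T n' m'} {a α A} →
          Γ ⊢ a ∶ α ╲ Γ' →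
          Γ ▸ A ⊢ a ∶ α ╲ Γ'

-- The inclusion of Γ' in Γ.  It is the identity when variables and names are
-- written explicitly, but shifts de Bruijn indices.

emb : ∀ {T} {Γ : Cx T n m} {Γ' : Cx T n' m'} {a α} →
      Γ ⊢ a ∶ α ╲ Γ' → Ren n' m' n m
emb here      = wkⁿ
emb (skipⁿ r) = liftⁿ (emb r)
emb (skipᵛ r) = ren (suc ∘ Ren.onVar (emb r)) (Ren.onName (emb r))

data _∋ⁿ_∶_ {T : ℕ → ℕ → Set} : Cx T n m → Fin m → NameTy → Set where
  here  : ∀ {Γ : Cx T n m} {α} → Γ # α ∋ⁿ zero ∶ α
  skipⁿ : ∀ {Γ : Cx T n m} {a α β} → Γ ∋ⁿ a ∶ α → Γ # β ∋ⁿ suc a ∶ α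
  skipᵛ : ∀ {Γ : Cx T n m} {a α A} → Γ ∋ⁿ a ∶ α → Γ ▸ A ∋ⁿ a ∶ α

data _∋_∶_ : Ctx n m → Fin n → Ty n m → Set where
  here  : ∀ {Γ : Ctx n m} {A} → Γ ▸ A ∋ zero ∶ renTy wkᵛ A
  skipⁿ : ∀ {Γ : Ctx n m} {x A β} → Γ ∋ x ∶ A → Γ # β ∋ x ∶ renTy wkⁿ A
  skipᵛ : ∀ {Γ : Ctx n m} {x A B} → Γ ∋ x ∶ A → Γ ▸ B ∋ suc x ∶ renTy wkᵛ A

------------------------------------------------------------------------
-- Typing and definitional equality

-- Contexts are presupposed to be well-formed: a judgment on Γ is only of
-- interest when ⊢ Γ ctx.  So that every context in a derivation is well-formed
-- as soon as the context of its conclusion is, a rule with a premise over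
-- Γ ▸ A also has the premise Γ ⊢ᵗ A ∶ type, and one with a premise over Γ # α
-- has the premise (α ∶name) ∈ Σ.  In New-cong, tyExt, ƛ-cong, ⟨⟩-cong and
-- newExt this premise is there for that reason alone.  In ＠-β it is redundant,
-- as α is the name type of a name already in the context.

module Judgments (Σ : Sig) where

  infix 3 _⊢_kind _⊢ᵗ_∶_ _⊢_∶_ _⊢ᵏ_≐_ _⊢ᵗ_≐_∶_ _⊢_≐_∶_ ⊢_ctx

  mutual
    data _⊢_kind {n m} (Γ : Ctx n m) : Kind n m → Set where
      type : Γ ⊢ type kind
      Π    : ∀ {A K} →
             Γ ⊢ᵗ A ∶ type → Γ ▸ A ⊢ K kind →
             Γ ⊢ Π A K kind

    data _⊢ᵗ_∶_ {n m} (Γ : Ctx n m) : Ty n m → Kind n m → Set where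
      con  : ∀ {a K} → (a ∶ᵗ K) ∈ Σ → Γ ⊢ᵗ con a ∶ renKind fromClosed K
      app  : ∀ {A M B K} →
             Γ ⊢ᵗ A ∶ Π B K → Γ ⊢ M ∶ B →
             Γ ⊢ᵗ A · M ∶ K [ M ]ᵏ
      Π    : ∀ {A B} →
             Γ ⊢ᵗ A ∶ type → Γ ▸ A ⊢ᵗ B ∶ type →
             Γ ⊢ᵗ Π A B ∶ type
      name : ∀ {α} → (α ∶name) ∈ Σ → Γ ⊢ᵗ name α ∶ type
      New  : ∀ {α B} →
             (α ∶name) ∈ Σ → Γ # α ⊢ᵗ B ∶ type →
             Γ ⊢ᵗ New α B ∶ type
      conv : ∀ {A K K'} →
             Γ ⊢ᵗ A ∶ K' → Γ ⊢ᵏ K ≐ K' →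
             Γ ⊢ᵗ A ∶ K

    data _⊢_∶_ {n m} (Γ : Ctx n m) : Obj n m → Ty n m → Set where
      con  : ∀ {c A} → (c ∶ᵒ A) ∈ Σ → Γ ⊢ con c ∶ renTy fromClosed A
      var  : ∀ {x A} → Γ ∋ x ∶ A → Γ ⊢ var x ∶ A
      name : ∀ {a α} → Γ ∋ⁿ a ∶ α → Γ ⊢ name a ∶ name α
      lam  : ∀ {A M B} →
             Γ ⊢ᵗ A ∶ type → Γ ▸ A ⊢ M ∶ B →
             Γ ⊢ ƛ A M ∶ Π A B
      app  : ∀ {M N A B} →
             Γ ⊢ M ∶ Π A B → Γ ⊢ N ∶ A →
             Γ ⊢ M · N ∶ B [ N ]ᵗ
      abs  : ∀ {α M B} →
             (α ∶name) ∈ Σ → Γ # α ⊢ M ∶ B →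
             Γ ⊢ ⟨ α ⟩ M ∶ New α B
      conc : ∀ {n' m'} {Γ' : Ctx n' m'} {a α M B} →
             (r : Γ ⊢ a ∶ α ╲ Γ') → Γ' ⊢ M ∶ New α B →
             Γ ⊢ renObj (emb r) M ＠ a ∶ renTy (liftⁿ (emb r)) B [ a ]ⁿᵗ
      conv : ∀ {M A B} →
             Γ ⊢ M ∶ A → Γ ⊢ᵗ A ≐ B ∶ type →
             Γ ⊢ M ∶ B

    data _⊢ᵏ_≐_ {n m} (Γ : Ctx n m) : Kind n m → Kind n m → Set where
      sym    : ∀ {K L} → Γ ⊢ᵏ K ≐ L → Γ ⊢ᵏ L ≐ K
      trans  : ∀ {J K L} → Γ ⊢ᵏ J ≐ K → Γ ⊢ᵏ K ≐ L → Γ ⊢ᵏ J ≐ L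
      type   : Γ ⊢ᵏ type ≐ type
      Π-cong : ∀ {A B K L} →
               Γ ⊢ᵗ A ∶ type → Γ ⊢ᵗ A ≐ B ∶ type → Γ ▸ A ⊢ᵏ K ≐ L →
               Γ ⊢ᵏ Π A K ≐ Π B L

    data _⊢ᵗ_≐_∶_ {n m} (Γ : Ctx n m) :
         Ty n m → Ty n m → Kind n m → Set where
      sym      : ∀ {A B K} → Γ ⊢ᵗ A ≐ B ∶ K → Γ ⊢ᵗ B ≐ A ∶ K
      trans    : ∀ {A B C K} →
                 Γ ⊢ᵗ A ≐ B ∶ K → Γ ⊢ᵗ B ≐ C ∶ K → Γ ⊢ᵗ A ≐ C ∶ K
      conv     : ∀ {A B K L} →
                 Γ ⊢ᵗ A ≐ B ∶ K → Γ ⊢ᵏ K ≐ L → Γ ⊢ᵗ A ≐ B ∶ L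
      con      : ∀ {a K} → (a ∶ᵗ K) ∈ Σ →
                 Γ ⊢ᵗ con a ≐ con a ∶ renKind fromClosed K
      app-cong : ∀ {A B M N C K} →
                 Γ ⊢ᵗ A ≐ B ∶ Π C K → Γ ⊢ M ≐ N ∶ C →
                 Γ ⊢ᵗ A · M ≐ B · N ∶ K [ M ]ᵏ
      Π-cong   : ∀ {A₁ A₂ B₁ B₂} →
                 Γ ⊢ᵗ A₁ ∶ type → Γ ⊢ᵗ A₁ ≐ B₁ ∶ type →
                 Γ ▸ A₁ ⊢ᵗ A₂ ≐ B₂ ∶ type →
                 Γ ⊢ᵗ Π A₁ A₂ ≐ Π B₁ B₂ ∶ type
      tyExt    : ∀ {A₁ A₂ B K} →
                 Γ ⊢ᵗ B ∶ type →
                 Γ ▸ B ⊢ᵗ renTy wkᵛ A₁ · var zero ≐ renTy wkᵛ A₂ · var zero ∶ K →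
                 Γ ⊢ᵗ A₁ ≐ A₂ ∶ Π B K
      name     : ∀ {α} → (α ∶name) ∈ Σ → Γ ⊢ᵗ name α ≐ name α ∶ type
      New-cong : ∀ {α A B} →
                 (α ∶name) ∈ Σ → Γ # α ⊢ᵗ A ≐ B ∶ type →
                 Γ ⊢ᵗ New α A ≐ New α B ∶ type

    data _⊢_≐_∶_ {n m} (Γ : Ctx n m) :
         Obj n m → Obj n m → Ty n m → Set where
      sym      : ∀ {M N A} → Γ ⊢ M ≐ N ∶ A → Γ ⊢ N ≐ M ∶ A
      trans    : ∀ {M N P A} →
                 Γ ⊢ M ≐ N ∶ A → Γ ⊢ N ≐ P ∶ A → Γ ⊢ M ≐ P ∶ A
      conv     : ∀ {M N A B} →
                 Γ ⊢ M ≐ N ∶ A → Γ ⊢ᵗ A ≐ B ∶ type → Γ ⊢ M ≐ N ∶ B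
      var      : ∀ {x A} → Γ ∋ x ∶ A → Γ ⊢ var x ≐ var x ∶ A
      con      : ∀ {c A} → (c ∶ᵒ A) ∈ Σ →
                 Γ ⊢ con c ≐ con c ∶ renTy fromClosed A
      app-cong : ∀ {M₁ M₂ N₁ N₂ A B} →
                 Γ ⊢ M₁ ≐ N₁ ∶ Π A B → Γ ⊢ M₂ ≐ N₂ ∶ A →
                 Γ ⊢ M₁ · M₂ ≐ N₁ · N₂ ∶ B [ M₂ ]ᵗ
      ƛ-cong   : ∀ {A A' A'' B M N} →
                 Γ ⊢ᵗ A ∶ type →
                 Γ ⊢ᵗ A' ≐ A ∶ type → Γ ⊢ᵗ A'' ≐ A ∶ type →
                 Γ ▸ A ⊢ M ≐ N ∶ B →
                 Γ ⊢ ƛ A' M ≐ ƛ A'' N ∶ Π A B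
      β        : ∀ {A B M₁ M₂ N₁ N₂} →
                 Γ ⊢ᵗ A ∶ type → Γ ▸ A ⊢ M₂ ≐ N₂ ∶ B → Γ ⊢ M₁ ≐ N₁ ∶ A →
                 Γ ⊢ ƛ A M₂ · M₁ ≐ N₂ [ N₁ ] ∶ B [ M₁ ]ᵗ
      ext      : ∀ {M N A B} →
                 Γ ⊢ᵗ A ∶ type → Γ ⊢ M ∶ Π A B → Γ ⊢ N ∶ Π A B →
                 Γ ▸ A ⊢ renObj wkᵛ M · var zero ≐ renObj wkᵛ N · var zero ∶ B →
                 Γ ⊢ M ≐ N ∶ Π A B
      name     : ∀ {a α} → Γ ∋ⁿ a ∶ α → Γ ⊢ name a ≐ name a ∶ name α
      ⟨⟩-cong  : ∀ {α M N A} →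
                 (α ∶name) ∈ Σ → Γ # α ⊢ M ≐ N ∶ A →
                 Γ ⊢ ⟨ α ⟩ M ≐ ⟨ α ⟩ N ∶ New α A
      ＠-cong   : ∀ {n' m'} {Γ' : Ctx n' m'} {b α M N A} →
                 (r : Γ ⊢ b ∶ α ╲ Γ') → Γ' ⊢ M ≐ N ∶ New α A →
                 Γ ⊢ renObj (emb r) M ＠ b ≐ renObj (emb r) N ＠ b
                   ∶ renTy (liftⁿ (emb r)) A [ b ]ⁿᵗ
      ＠-β      : ∀ {n' m'} {Γ' : Ctx n' m'} {b α M N A} →
                 (r : Γ ⊢ b ∶ α ╲ Γ') → Γ' # α ⊢ M ≐ N ∶ A →
                 Γ ⊢ renObj (emb r) (⟨ α ⟩ M) ＠ b
                   ≐ renObj (liftⁿ (emb r)) N [ b ]ⁿ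
                   ∶ renTy (liftⁿ (emb r)) A [ b ]ⁿᵗ
      newExt   : ∀ {α M N A} →
                 (α ∶name) ∈ Σ →
                 Γ # α ⊢ renObj wkⁿ M ＠ zero ≐ renObj wkⁿ N ＠ zero ∶ A →
                 Γ ⊢ M ≐ N ∶ New α A

  data ⊢_ctx : Ctx n m → Set where
    ∙   : ⊢ ∙ ctx
    _▸_ : ∀ {Γ : Ctx n m} {A} → ⊢ Γ ctx → Γ ⊢ᵗ A ∶ type → ⊢ Γ ▸ A ctx
    _#_ : ∀ {Γ : Ctx n m} {α} → ⊢ Γ ctx → (α ∶name) ∈ Σ → ⊢ Γ # α ctx

data ⊢_sig : Sig → Set where
  []    : ⊢ [] sig
  objD  : ∀ {Σ c A} → ⊢ Σ sig → (∀ B → (c ∶ᵒ B) ∉ Σ) →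
          (let open Judgments Σ in ∙ ⊢ᵗ A ∶ type) →
          ⊢ (c ∶ᵒ A) ∷ Σ sig
  tyD   : ∀ {Σ a K} → ⊢ Σ sig → (∀ L → (a ∶ᵗ L) ∉ Σ) →
          (let open Judgments Σ in ∙ ⊢ K kind) →
          ⊢ (a ∶ᵗ K) ∷ Σ sig
  nameD : ∀ {Σ α} → ⊢ Σ sig → (α ∶name) ∉ Σ →
          ⊢ (α ∶name) ∷ Σ sig

------------------------------------------------------------------------
-- Erasure

data STy : Set where
  con   : TyConst → STy
  _⇒_   : STy → STy → STy
  ⟨_⟩ˢ_ : NameTy → STy → STy
  name  : NameTy → STy

infix 20 _⁻ _⁻ᶜ

_⁻ : Ty n m → STy
con a ⁻     = con a
(A · M) ⁻   = A ⁻
(Π A B) ⁻   = A ⁻ ⇒ B ⁻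
name α ⁻    = name α
(New α A) ⁻ = ⟨ α ⟩ˢ A ⁻

SCtx : ℕ → ℕ → Set
SCtx = Cx (λ _ _ → STy)

_⁻ᶜ : Ctx n m → SCtx n m
∙ ⁻ᶜ       = ∙
(Γ ▸ A) ⁻ᶜ = Γ ⁻ᶜ ▸ A ⁻
(Γ # α) ⁻ᶜ = Γ ⁻ᶜ # α

data _∋ˢ_∶_ : SCtx n m → Fin n → STy → Set where
  here  : ∀ {Δ : SCtx n m} {τ} → Δ ▸ τ ∋ˢ zero ∶ τ
  skipⁿ : ∀ {Δ : SCtx n m} {x τ β} → Δ ∋ˢ x ∶ τ → Δ # β ∋ˢ x ∶ τ
  skipᵛ : ∀ {Δ : SCtx n m} {x τ υ} → Δ ∋ˢ x ∶ τ → Δ ▸ υ ∋ˢ suc x ∶ τ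

------------------------------------------------------------------------
-- Equivalence algorithm

data _→wh_ {n m} : Obj n m → Obj n m → Set where
  β    : ∀ {A M N} → ƛ A M · N →wh M [ N ]
  ＠-β  : ∀ {α M b} → (⟨ α ⟩ M) ＠ b →wh M [ b ]ⁿ
  appˡ : ∀ {M M' N} → M →wh M' → M · N →wh M' · N
  ＠ˡ   : ∀ {M M' a} → M →wh M' → M ＠ a →wh M' ＠ a

data Base : STy → Set where
  con  : ∀ a → Base (con a)
  name : ∀ α → Base (name α)

module Algorithm (Σ : Sig) where

  infix 3 _⊢_⇔_∶_ _⊢_↔_∶_

  mutual
    data _⊢_⇔_∶_ {n m} (Δ : SCtx n m) :
         Obj n m → Obj n m → STy → Set where
      whˡ    : ∀ {M M' N δ} → Base δ →
               M →wh M' → Δ ⊢ M' ⇔ N ∶ δ → Δ ⊢ M ⇔ N ∶ δ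
      whʳ    : ∀ {M N N' δ} → Base δ →
               N →wh N' → Δ ⊢ M ⇔ N' ∶ δ → Δ ⊢ M ⇔ N ∶ δ
      struct : ∀ {M N δ} → Base δ →
               Δ ⊢ M ↔ N ∶ δ → Δ ⊢ M ⇔ N ∶ δ
      ext    : ∀ {M N τ₁ τ₂} →
               Δ ▸ τ₁ ⊢ renObj wkᵛ M · var zero ⇔ renObj wkᵛ N · var zero ∶ τ₂ →
               Δ ⊢ M ⇔ N ∶ τ₁ ⇒ τ₂
      newExt : ∀ {M N α τ} →
               Δ # α ⊢ renObj wkⁿ M ＠ zero ⇔ renObj wkⁿ N ＠ zero ∶ τ →
               Δ ⊢ M ⇔ N ∶ ⟨ α ⟩ˢ τ

    data _⊢_↔_∶_ {n m} (Δ : SCtx n m) :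
         Obj n m → Obj n m → STy → Set where
      var  : ∀ {x τ} → Δ ∋ˢ x ∶ τ → Δ ⊢ var x ↔ var x ∶ τ
      con  : ∀ {c A} → (c ∶ᵒ A) ∈ Σ → Δ ⊢ con c ↔ con c ∶ A ⁻
      name : ∀ {a α} → Δ ∋ⁿ a ∶ α → Δ ⊢ name a ↔ name a ∶ name α
      app  : ∀ {M₁ M₂ N₁ N₂ τ₁ τ₂} →
             Δ ⊢ M₁ ↔ N₁ ∶ τ₁ ⇒ τ₂ → Δ ⊢ M₂ ⇔ N₂ ∶ τ₁ →
             Δ ⊢ M₁ · M₂ ↔ N₁ · N₂ ∶ τ₂
      conc : ∀ {n' m'} {Δ' : SCtx n' m'} {M N a α τ} →
             (r : Δ ⊢ a ∶ α ╲ Δ') → Δ' ⊢ M ↔ N ∶ ⟨ α ⟩ˢ τ →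
             Δ ⊢ renObj (emb r) M ＠ a ↔ renObj (emb r) N ＠ a ∶ τ

{-# OPTIONS --safe #-}
module Submission where

-- Soundness follows by induction on the algorithmic derivations once types of
-- well-typed objects are known to be types.  This regularity is the delicate
-- part: tyExt has no premise typing its two families, and recovering their kinds
-- from Γ ▸ B would need strengthening.  Instead, equal families are shown, under
-- every substitution, to become types on all well-typed arguments; the case tyExt
-- then extends the substitution by the argument.

open import Defs
open import Data.Empty using (⊥-elim)
open import Data.Fin.Base using (Fin; zero; suc; lift)
open import Data.Fin.Properties using (suc-injective)
open import Data.List.Membership.Propositional using (_∈_)
open import Data.List.Relation.Unary.Any using (here; there)
open import Data.Nat.Base using (ℕ; zero; suc)
open import Data.Product.Base using (_×_; _,_; proj₁; proj₂; Σ-syntax; ∃-syntax)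
open import Data.Sum.Base using (_⊎_; inj₁; inj₂)
import Data.Vec.Functional as Vector
open import Function.Base using (id; _∘_)
open import Relation.Binary.PropositionalEquality
  using (_≡_; refl; sym; trans; cong; cong₂; subst; subst₂; module ≡-Reasoning)

-- Rule `conc` shapes much of the development. It types `M` over a restriction, so in de Bruijn form
-- the object under `＠` is an image under `emb r` and inversion only returns a preimage. Hence the
-- injectivity of renaming, the uniqueness of restrictions, and the study of reducts of renamed
-- objects. Rule `conc` also means that a substitution preserves typing only if it respects
-- restriction: one that identifies two names turns `M ＠ a ＠ b` into an object in which the same
-- name is used twice. `SubRel` therefore stores, for each name, a factorisation through a
-- restriction of the target. The two sides of a structural equivalence come with unrelated types,
-- so their equality has to be produced by the induction: in an application, equality of the
-- function types must give equality of the domains before the arguments can be compared. The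
-- injectivity of `Π` and `New` that this takes is available by a plain induction on equality
-- derivations, because type families have no abstraction and hence no β-rule.

private variable
  n m n' m' n₁ m₁ n₂ m₂ : ℕ

-- Substitution algebra

infix 4 _≈_
-- Pointwise, because substitutions contain functions and no function extensionality is assumed.
record _≈_ (σ τ : Sub n m n' m') : Set where
  constructor _,_
  field
    onVar  : ∀ x → Sub.onVar σ x ≡ Sub.onVar τ x
    onName : ∀ a → Sub.onName σ a ≡ Sub.onName τ a

≈-refl : {σ : Sub n m n' m'} → σ ≈ σ
≈-refl = (λ _ → refl) , (λ _ → refl)

≈-trans : {σ τ υ : Sub n m n' m'} → σ ≈ τ → τ ≈ υ → σ ≈ υ
≈-trans (p , q) (p' , q') = (λ x → trans (p x) (p' x)) , (λ a → trans (q a) (q' a))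

ι : Ren n m n' m' → Sub n m n' m'
ι (ren f g) = sub (var ∘ f) g

idˢ : Sub n m n m
idˢ = sub var id

infixr 9 _ˢ∘ʳ_ _ʳ∘ˢ_ _ˢ∘ˢ_

-- The fusion laws for the composites build on one another: lifting `_ʳ∘ˢ_` uses fusion for `_ˢ∘ʳ_`,
-- and lifting `_ˢ∘ˢ_` uses both of these.
_ˢ∘ʳ_ : Sub n₁ m₁ n₂ m₂ → Ren n m n₁ m₁ → Sub n m n₂ m₂
σ ˢ∘ʳ ρ = sub (Sub.onVar σ ∘ Ren.onVar ρ) (Sub.onName σ ∘ Ren.onName ρ)

_ʳ∘ˢ_ : Ren n₁ m₁ n₂ m₂ → Sub n m n₁ m₁ → Sub n m n₂ m₂
ρ ʳ∘ˢ σ = sub (renObj ρ ∘ Sub.onVar σ) (Ren.onName ρ ∘ Sub.onName σ)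

_ˢ∘ˢ_ : Sub n₁ m₁ n₂ m₂ → Sub n m n₁ m₁ → Sub n m n₂ m₂
σ ˢ∘ˢ τ = sub (subObj σ ∘ Sub.onVar τ) (Sub.onName σ ∘ Sub.onName τ)

liftˢᵛ-≈ : {σ τ : Sub n m n' m'} → σ ≈ τ → liftˢᵛ σ ≈ liftˢᵛ τ
liftˢᵛ-≈ (p , q) = (λ { zero → refl ; (suc x) → cong (renObj wkᵛ) (p x) }) , q

liftˢⁿ-≈ : {σ τ : Sub n m n' m'} → σ ≈ τ → liftˢⁿ σ ≈ liftˢⁿ τ
liftˢⁿ-≈ (p , q) =
  (λ x → cong (renObj wkⁿ) (p x)) , (λ { zero → refl ; (suc a) → cong suc (q a) })

mutual
  subTy-cong : {σ τ : Sub n m n' m'} → σ ≈ τ → ∀ A → subTy σ A ≡ subTy τ A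
  subTy-cong e (con a)   = refl
  subTy-cong e (A · M)   = cong₂ _·_ (subTy-cong e A) (subObj-cong e M)
  subTy-cong e (Π A B)   = cong₂ Π (subTy-cong e A) (subTy-cong (liftˢᵛ-≈ e) B)
  subTy-cong e (name α)  = refl
  subTy-cong e (New α B) = cong (New α) (subTy-cong (liftˢⁿ-≈ e) B)

  subObj-cong : {σ τ : Sub n m n' m'} → σ ≈ τ → ∀ M → subObj σ M ≡ subObj τ M
  subObj-cong e (con c)   = refl
  subObj-cong e (var x)   = _≈_.onVar e x
  subObj-cong e (ƛ A M)   = cong₂ ƛ (subTy-cong e A) (subObj-cong (liftˢᵛ-≈ e) M)
  subObj-cong e (M · N)   = cong₂ _·_ (subObj-cong e M) (subObj-cong e N)
  subObj-cong e (name a)  = cong name (_≈_.onName e a)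
  subObj-cong e (⟨ α ⟩ M) = cong (⟨ α ⟩_) (subObj-cong (liftˢⁿ-≈ e) M)
  subObj-cong e (M ＠ a)   = cong₂ _＠_ (subObj-cong e M) (_≈_.onName e a)

subKind-cong : {σ τ : Sub n m n' m'} → σ ≈ τ → ∀ K → subKind σ K ≡ subKind τ K
subKind-cong e type    = refl
subKind-cong e (Π A K) = cong₂ Π (subTy-cong e A) (subKind-cong (liftˢᵛ-≈ e) K)

liftˢᵛ-ι : (ρ : Ren n m n' m') → ι (liftᵛ ρ) ≈ liftˢᵛ (ι ρ)
liftˢᵛ-ι ρ = (λ { zero → refl ; (suc x) → refl }) , (λ _ → refl)

mutual
  -- Viewing a renaming as a substitution spares a renaming after a renaming an induction of its
  -- own: it is a case of `_ˢ∘ʳ_`.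
  renTy-ι : ∀ (ρ : Ren n m n' m') A → renTy ρ A ≡ subTy (ι ρ) A
  renTy-ι ρ (con a)   = refl
  renTy-ι ρ (A · M)   = cong₂ _·_ (renTy-ι ρ A) (renObj-ι ρ M)
  renTy-ι ρ (Π A B)   =
    cong₂ Π (renTy-ι ρ A) (trans (renTy-ι (liftᵛ ρ) B) (subTy-cong (liftˢᵛ-ι ρ) B))
  renTy-ι ρ (name α)  = refl
  renTy-ι ρ (New α B) = cong (New α) (renTy-ι (liftⁿ ρ) B)

  renObj-ι : ∀ (ρ : Ren n m n' m') M → renObj ρ M ≡ subObj (ι ρ) M
  renObj-ι ρ (con c)   = refl
  renObj-ι ρ (var x)   = refl
  renObj-ι ρ (ƛ A M)   =
    cong₂ ƛ (renTy-ι ρ A) (trans (renObj-ι (liftᵛ ρ) M) (subObj-cong (liftˢᵛ-ι ρ) M))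
  renObj-ι ρ (M · N)   = cong₂ _·_ (renObj-ι ρ M) (renObj-ι ρ N)
  renObj-ι ρ (name a)  = refl
  renObj-ι ρ (⟨ α ⟩ M) = cong (⟨ α ⟩_) (renObj-ι (liftⁿ ρ) M)
  renObj-ι ρ (M ＠ a)   = cong (_＠ _) (renObj-ι ρ M)

renKind-ι : ∀ (ρ : Ren n m n' m') K → renKind ρ K ≡ subKind (ι ρ) K
renKind-ι ρ type    = refl
renKind-ι ρ (Π A K) =
  cong₂ Π (renTy-ι ρ A) (trans (renKind-ι (liftᵛ ρ) K) (subKind-cong (liftˢᵛ-ι ρ) K))

liftˢᵛ-ˢ∘ʳ : (σ : Sub n₁ m₁ n₂ m₂) (ρ : Ren n m n₁ m₁) →
             liftˢᵛ σ ˢ∘ʳ liftᵛ ρ ≈ liftˢᵛ (σ ˢ∘ʳ ρ)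
liftˢᵛ-ˢ∘ʳ σ ρ = (λ { zero → refl ; (suc x) → refl }) , (λ _ → refl)

liftˢⁿ-ˢ∘ʳ : (σ : Sub n₁ m₁ n₂ m₂) (ρ : Ren n m n₁ m₁) →
             liftˢⁿ σ ˢ∘ʳ liftⁿ ρ ≈ liftˢⁿ (σ ˢ∘ʳ ρ)
liftˢⁿ-ˢ∘ʳ σ ρ = (λ _ → refl) , (λ { zero → refl ; (suc x) → refl })

mutual
  subTy-renTy : ∀ (σ : Sub n₁ m₁ n₂ m₂) (ρ : Ren n m n₁ m₁) A →
                subTy σ (renTy ρ A) ≡ subTy (σ ˢ∘ʳ ρ) A
  subTy-renTy σ ρ (con a)   = refl
  subTy-renTy σ ρ (A · M)   = cong₂ _·_ (subTy-renTy σ ρ A) (subObj-renObj σ ρ M)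
  subTy-renTy σ ρ (Π A B)   = cong₂ Π (subTy-renTy σ ρ A)
    (trans (subTy-renTy (liftˢᵛ σ) (liftᵛ ρ) B) (subTy-cong (liftˢᵛ-ˢ∘ʳ σ ρ) B))
  subTy-renTy σ ρ (name α)  = refl
  subTy-renTy σ ρ (New α B) = cong (New α)
    (trans (subTy-renTy (liftˢⁿ σ) (liftⁿ ρ) B) (subTy-cong (liftˢⁿ-ˢ∘ʳ σ ρ) B))

  subObj-renObj : ∀ (σ : Sub n₁ m₁ n₂ m₂) (ρ : Ren n m n₁ m₁) M →
                  subObj σ (renObj ρ M) ≡ subObj (σ ˢ∘ʳ ρ) M
  subObj-renObj σ ρ (con c)   = refl
  subObj-renObj σ ρ (var x)   = refl
  subObj-renObj σ ρ (ƛ A M)   = cong₂ ƛ (subTy-renTy σ ρ A)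
    (trans (subObj-renObj (liftˢᵛ σ) (liftᵛ ρ) M) (subObj-cong (liftˢᵛ-ˢ∘ʳ σ ρ) M))
  subObj-renObj σ ρ (M · N)   = cong₂ _·_ (subObj-renObj σ ρ M) (subObj-renObj σ ρ N)
  subObj-renObj σ ρ (name a)  = refl
  subObj-renObj σ ρ (⟨ α ⟩ M) = cong (⟨ α ⟩_)
    (trans (subObj-renObj (liftˢⁿ σ) (liftⁿ ρ) M) (subObj-cong (liftˢⁿ-ˢ∘ʳ σ ρ) M))
  subObj-renObj σ ρ (M ＠ a)   = cong (_＠ _) (subObj-renObj σ ρ M)

subKind-renKind : ∀ (σ : Sub n₁ m₁ n₂ m₂) (ρ : Ren n m n₁ m₁) K →
                  subKind σ (renKind ρ K) ≡ subKind (σ ˢ∘ʳ ρ) K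
subKind-renKind σ ρ type    = refl
subKind-renKind σ ρ (Π A K) = cong₂ Π (subTy-renTy σ ρ A)
  (trans (subKind-renKind (liftˢᵛ σ) (liftᵛ ρ) K) (subKind-cong (liftˢᵛ-ˢ∘ʳ σ ρ) K))

renObj-renObj : ∀ (ρ : Ren n₁ m₁ n₂ m₂) (ρ' : Ren n m n₁ m₁) M →
                renObj ρ (renObj ρ' M) ≡ subObj (ι ρ ˢ∘ʳ ρ') M
renObj-renObj ρ ρ' M = trans (renObj-ι ρ (renObj ρ' M)) (subObj-renObj (ι ρ) ρ' M)

-- In the squares that move a weakening past a lifted renaming both composites are equal by
-- computation, so `≈-refl` proves the hypothesis.
renObj-square : {ρ : Ren n₁ m₁ n₂ m₂} {ρ' : Ren n m n₁ m₁}
                {υ : Ren n' m' n₂ m₂} {υ' : Ren n m n' m'} →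
                ι ρ ˢ∘ʳ ρ' ≈ ι υ ˢ∘ʳ υ' → ∀ M →
                renObj ρ (renObj ρ' M) ≡ renObj υ (renObj υ' M)
renObj-square {ρ = ρ} {ρ'} {υ} {υ'} e M =
  trans (renObj-renObj ρ ρ' M) (trans (subObj-cong e M) (sym (renObj-renObj υ υ' M)))

liftˢᵛ-ʳ∘ˢ : (ρ : Ren n₁ m₁ n₂ m₂) (σ : Sub n m n₁ m₁) →
             liftᵛ ρ ʳ∘ˢ liftˢᵛ σ ≈ liftˢᵛ (ρ ʳ∘ˢ σ)
liftˢᵛ-ʳ∘ˢ ρ σ =
  (λ { zero → refl ; (suc x) → renObj-square ≈-refl (Sub.onVar σ x) }) , (λ _ → refl)

liftˢⁿ-ʳ∘ˢ : (ρ : Ren n₁ m₁ n₂ m₂) (σ : Sub n m n₁ m₁) →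
             liftⁿ ρ ʳ∘ˢ liftˢⁿ σ ≈ liftˢⁿ (ρ ʳ∘ˢ σ)
liftˢⁿ-ʳ∘ˢ ρ σ =
  (λ x → renObj-square ≈-refl (Sub.onVar σ x)) , (λ { zero → refl ; (suc x) → refl })

mutual
  renTy-subTy : ∀ (ρ : Ren n₁ m₁ n₂ m₂) (σ : Sub n m n₁ m₁) A →
                renTy ρ (subTy σ A) ≡ subTy (ρ ʳ∘ˢ σ) A
  renTy-subTy ρ σ (con a)   = refl
  renTy-subTy ρ σ (A · M)   = cong₂ _·_ (renTy-subTy ρ σ A) (renObj-subObj ρ σ M)
  renTy-subTy ρ σ (Π A B)   = cong₂ Π (renTy-subTy ρ σ A)
    (trans (renTy-subTy (liftᵛ ρ) (liftˢᵛ σ) B) (subTy-cong (liftˢᵛ-ʳ∘ˢ ρ σ) B))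
  renTy-subTy ρ σ (name α)  = refl
  renTy-subTy ρ σ (New α B) = cong (New α)
    (trans (renTy-subTy (liftⁿ ρ) (liftˢⁿ σ) B) (subTy-cong (liftˢⁿ-ʳ∘ˢ ρ σ) B))

  renObj-subObj : ∀ (ρ : Ren n₁ m₁ n₂ m₂) (σ : Sub n m n₁ m₁) M →
                  renObj ρ (subObj σ M) ≡ subObj (ρ ʳ∘ˢ σ) M
  renObj-subObj ρ σ (con c)   = refl
  renObj-subObj ρ σ (var x)   = refl
  renObj-subObj ρ σ (ƛ A M)   = cong₂ ƛ (renTy-subTy ρ σ A)
    (trans (renObj-subObj (liftᵛ ρ) (liftˢᵛ σ) M) (subObj-cong (liftˢᵛ-ʳ∘ˢ ρ σ) M))
  renObj-subObj ρ σ (M · N)   = cong₂ _·_ (renObj-subObj ρ σ M) (renObj-subObj ρ σ N)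
  renObj-subObj ρ σ (name a)  = refl
  renObj-subObj ρ σ (⟨ α ⟩ M) = cong (⟨ α ⟩_)
    (trans (renObj-subObj (liftⁿ ρ) (liftˢⁿ σ) M) (subObj-cong (liftˢⁿ-ʳ∘ˢ ρ σ) M))
  renObj-subObj ρ σ (M ＠ a)   = cong (_＠ _) (renObj-subObj ρ σ M)

renKind-subKind : ∀ (ρ : Ren n₁ m₁ n₂ m₂) (σ : Sub n m n₁ m₁) K →
                  renKind ρ (subKind σ K) ≡ subKind (ρ ʳ∘ˢ σ) K
renKind-subKind ρ σ type    = refl
renKind-subKind ρ σ (Π A K) = cong₂ Π (renTy-subTy ρ σ A)
  (trans (renKind-subKind (liftᵛ ρ) (liftˢᵛ σ) K) (subKind-cong (liftˢᵛ-ʳ∘ˢ ρ σ) K))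

liftˢᵛ-ˢ∘ˢ : (σ : Sub n₁ m₁ n₂ m₂) (τ : Sub n m n₁ m₁) →
             liftˢᵛ σ ˢ∘ˢ liftˢᵛ τ ≈ liftˢᵛ (σ ˢ∘ˢ τ)
liftˢᵛ-ˢ∘ˢ σ τ =
  (λ { zero → refl
     ; (suc x) → trans (subObj-renObj (liftˢᵛ σ) wkᵛ (Sub.onVar τ x))
                       (sym (renObj-subObj wkᵛ σ (Sub.onVar τ x))) }) , (λ _ → refl)

liftˢⁿ-ˢ∘ˢ : (σ : Sub n₁ m₁ n₂ m₂) (τ : Sub n m n₁ m₁) →
             liftˢⁿ σ ˢ∘ˢ liftˢⁿ τ ≈ liftˢⁿ (σ ˢ∘ˢ τ)
liftˢⁿ-ˢ∘ˢ σ τ =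
  (λ x → trans (subObj-renObj (liftˢⁿ σ) wkⁿ (Sub.onVar τ x))
               (sym (renObj-subObj wkⁿ σ (Sub.onVar τ x)))) ,
  (λ { zero → refl ; (suc a) → refl })

mutual
  subTy-subTy : ∀ (σ : Sub n₁ m₁ n₂ m₂) (τ : Sub n m n₁ m₁) A →
                subTy σ (subTy τ A) ≡ subTy (σ ˢ∘ˢ τ) A
  subTy-subTy σ τ (con a)   = refl
  subTy-subTy σ τ (A · M)   = cong₂ _·_ (subTy-subTy σ τ A) (subObj-subObj σ τ M)
  subTy-subTy σ τ (Π A B)   = cong₂ Π (subTy-subTy σ τ A)
    (trans (subTy-subTy (liftˢᵛ σ) (liftˢᵛ τ) B) (subTy-cong (liftˢᵛ-ˢ∘ˢ σ τ) B))
  subTy-subTy σ τ (name α)  = refl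
  subTy-subTy σ τ (New α B) = cong (New α)
    (trans (subTy-subTy (liftˢⁿ σ) (liftˢⁿ τ) B) (subTy-cong (liftˢⁿ-ˢ∘ˢ σ τ) B))

  subObj-subObj : ∀ (σ : Sub n₁ m₁ n₂ m₂) (τ : Sub n m n₁ m₁) M →
                  subObj σ (subObj τ M) ≡ subObj (σ ˢ∘ˢ τ) M
  subObj-subObj σ τ (con c)   = refl
  subObj-subObj σ τ (var x)   = refl
  subObj-subObj σ τ (ƛ A M)   = cong₂ ƛ (subTy-subTy σ τ A)
    (trans (subObj-subObj (liftˢᵛ σ) (liftˢᵛ τ) M) (subObj-cong (liftˢᵛ-ˢ∘ˢ σ τ) M))
  subObj-subObj σ τ (M · N)   = cong₂ _·_ (subObj-subObj σ τ M) (subObj-subObj σ τ N)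
  subObj-subObj σ τ (name a)  = refl
  subObj-subObj σ τ (⟨ α ⟩ M) = cong (⟨ α ⟩_)
    (trans (subObj-subObj (liftˢⁿ σ) (liftˢⁿ τ) M) (subObj-cong (liftˢⁿ-ˢ∘ˢ σ τ) M))
  subObj-subObj σ τ (M ＠ a)   = cong (_＠ _) (subObj-subObj σ τ M)

subKind-subKind : ∀ (σ : Sub n₁ m₁ n₂ m₂) (τ : Sub n m n₁ m₁) K →
                  subKind σ (subKind τ K) ≡ subKind (σ ˢ∘ˢ τ) K
subKind-subKind σ τ type    = refl
subKind-subKind σ τ (Π A K) = cong₂ Π (subTy-subTy σ τ A)
  (trans (subKind-subKind (liftˢᵛ σ) (liftˢᵛ τ) K) (subKind-cong (liftˢᵛ-ˢ∘ˢ σ τ) K))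

liftˢᵛ-id : liftˢᵛ (idˢ {n} {m}) ≈ idˢ
liftˢᵛ-id = (λ { zero → refl ; (suc x) → refl }) , (λ _ → refl)

liftˢⁿ-id : liftˢⁿ (idˢ {n} {m}) ≈ idˢ
liftˢⁿ-id = (λ _ → refl) , (λ { zero → refl ; (suc a) → refl })

mutual
  subTy-id : (A : Ty n m) → subTy idˢ A ≡ A
  subTy-id (con a)   = refl
  subTy-id (A · M)   = cong₂ _·_ (subTy-id A) (subObj-id M)
  subTy-id (Π A B)   = cong₂ Π (subTy-id A) (trans (subTy-cong liftˢᵛ-id B) (subTy-id B))
  subTy-id (name α)  = refl
  subTy-id (New α B) = cong (New α) (trans (subTy-cong liftˢⁿ-id B) (subTy-id B))

  subObj-id : (M : Obj n m) → subObj idˢ M ≡ M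
  subObj-id (con c)   = refl
  subObj-id (var x)   = refl
  subObj-id (ƛ A M)   = cong₂ ƛ (subTy-id A) (trans (subObj-cong liftˢᵛ-id M) (subObj-id M))
  subObj-id (M · N)   = cong₂ _·_ (subObj-id M) (subObj-id N)
  subObj-id (name a)  = refl
  subObj-id (⟨ α ⟩ M) = cong (⟨ α ⟩_) (trans (subObj-cong liftˢⁿ-id M) (subObj-id M))
  subObj-id (M ＠ a)   = cong (_＠ a) (subObj-id M)

subKind-id : (K : Kind n m) → subKind idˢ K ≡ K
subKind-id type    = refl
subKind-id (Π A K) = cong₂ Π (subTy-id A) (trans (subKind-cong liftˢᵛ-id K) (subKind-id K))

-- Substitution laws uniform in types, objects and kinds

data Sort : Set where
  ty obj kind : Sort

Expr : Sort → ℕ → ℕ → Set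
Expr ty   = Ty
Expr obj  = Obj
Expr kind = Kind

renE : ∀ s → Ren n m n' m' → Expr s n m → Expr s n' m'
renE ty   = renTy
renE obj  = renObj
renE kind = renKind

subE : ∀ s → Sub n m n' m' → Expr s n m → Expr s n' m'
subE ty   = subTy
subE obj  = subObj
subE kind = subKind

subE-cong : ∀ s {σ τ : Sub n m n' m'} → σ ≈ τ → ∀ T → subE s σ T ≡ subE s τ T
subE-cong ty   = subTy-cong
subE-cong obj  = subObj-cong
subE-cong kind = subKind-cong

subE-id : ∀ s (T : Expr s n m) → subE s idˢ T ≡ T
subE-id ty   = subTy-id
subE-id obj  = subObj-id
subE-id kind = subKind-id

renE-ι : ∀ s (ρ : Ren n m n' m') T → renE s ρ T ≡ subE s (ι ρ) T
renE-ι ty   = renTy-ι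
renE-ι obj  = renObj-ι
renE-ι kind = renKind-ι

subE-renE : ∀ s (σ : Sub n₁ m₁ n₂ m₂) (ρ : Ren n m n₁ m₁) T →
            subE s σ (renE s ρ T) ≡ subE s (σ ˢ∘ʳ ρ) T
subE-renE ty   = subTy-renTy
subE-renE obj  = subObj-renObj
subE-renE kind = subKind-renKind

renE-subE : ∀ s (ρ : Ren n₁ m₁ n₂ m₂) (σ : Sub n m n₁ m₁) T →
            renE s ρ (subE s σ T) ≡ subE s (ρ ʳ∘ˢ σ) T
renE-subE ty   = renTy-subTy
renE-subE obj  = renObj-subObj
renE-subE kind = renKind-subKind

subE-subE : ∀ s (σ : Sub n₁ m₁ n₂ m₂) (τ : Sub n m n₁ m₁) T →
            subE s σ (subE s τ T) ≡ subE s (σ ˢ∘ˢ τ) T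
subE-subE ty   = subTy-subTy
subE-subE obj  = subObj-subObj
subE-subE kind = subKind-subKind

renE-renE : ∀ s (ρ : Ren n₁ m₁ n₂ m₂) (ρ' : Ren n m n₁ m₁) T →
            renE s ρ (renE s ρ' T) ≡ subE s (ι ρ ˢ∘ʳ ρ') T
renE-renE s ρ ρ' T = trans (renE-ι s ρ _) (subE-renE s (ι ρ) ρ' T)

-- The form in which restriction enters: `ρ` and `ρ'` are then the embeddings of a restriction of
-- the source and one of the target, and `σ'` is `σ` between the restricted contexts.
subE-renE-comm : ∀ s {σ : Sub n₁ m₁ n₂ m₂} {ρ : Ren n m n₁ m₁}
                 {ρ' : Ren n' m' n₂ m₂} {σ' : Sub n m n' m'} →
                 σ ˢ∘ʳ ρ ≈ ρ' ʳ∘ˢ σ' → ∀ T → subE s σ (renE s ρ T) ≡ renE s ρ' (subE s σ' T)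
subE-renE-comm s {σ} {ρ} {ρ'} {σ'} e T =
  trans (subE-renE s σ ρ T) (trans (subE-cong s e T) (sym (renE-subE s ρ' σ' T)))

subE-wkᵛ : ∀ s (σ : Sub n m n' m') T → subE s (liftˢᵛ σ) (renE s wkᵛ T) ≡ renE s wkᵛ (subE s σ T)
subE-wkᵛ s σ = subE-renE-comm s ≈-refl

subE-wkⁿ : ∀ s (σ : Sub n m n' m') T → subE s (liftˢⁿ σ) (renE s wkⁿ T) ≡ renE s wkⁿ (subE s σ T)
subE-wkⁿ s σ = subE-renE-comm s ≈-refl

instVar-wkᵛ : ∀ s (N : Obj n m) T → subE s (instVar N) (renE s wkᵛ T) ≡ T
instVar-wkᵛ s N T = trans (subE-renE s (instVar N) wkᵛ T) (subE-id s T)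

consˢ : Obj n' m' → Sub n m n' m' → Sub (suc n) m n' m'
consˢ N σ = sub (N Vector.∷ Sub.onVar σ) (Sub.onName σ)

-- Trades an argument of a family for an entry of the substitution, which is what the treatment of
-- product kinds in the regularity proof rests on.
instVar-liftˢᵛ : ∀ s N (σ : Sub n m n' m') T →
                 subE s (instVar N) (subE s (liftˢᵛ σ) T) ≡ subE s (consˢ N σ) T
instVar-liftˢᵛ s N σ T = trans (subE-subE s (instVar N) (liftˢᵛ σ) T) (subE-cong s
  ((λ { zero → refl ; (suc x) → instVar-wkᵛ obj N (Sub.onVar σ x) }) , (λ _ → refl)) T)

subE-instVar : ∀ s (σ : Sub n m n' m') N T →
               subE s σ (subE s (instVar N) T) ≡
               subE s (instVar (subObj σ N)) (subE s (liftˢᵛ σ) T)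
subE-instVar s σ N T = trans (subE-subE s σ (instVar N) T) (trans
  (subE-cong s ((λ { zero → refl ; (suc x) → refl }) , (λ _ → refl)) T)
  (sym (instVar-liftˢᵛ s (subObj σ N) σ T)))

-- Computes the type of an η-expansion: `renObj wkᵛ M · var zero` receives the weakened codomain
-- instantiated at `var zero`. The next lemma does the same for `＠`.
instVar-liftᵛ-wkᵛ : ∀ s (T : Expr s (suc n) m) →
                    subE s (instVar (var zero)) (renE s (liftᵛ wkᵛ) T) ≡ T
instVar-liftᵛ-wkᵛ s T = trans (subE-renE s (instVar (var zero)) (liftᵛ wkᵛ) T)
  (trans (subE-cong s ((λ { zero → refl ; (suc x) → refl }) , (λ _ → refl)) T) (subE-id s T))

instName-liftⁿ-wkⁿ : ∀ s (T : Expr s n (suc m)) →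
                     renE s (instName zero) (renE s (liftⁿ wkⁿ) T) ≡ T
instName-liftⁿ-wkⁿ s T = trans (renE-renE s (instName zero) (liftⁿ wkⁿ) T)
  (trans (subE-cong s ((λ _ → refl) , (λ { zero → refl ; (suc a) → refl })) T) (subE-id s T))

subE-closed : ∀ s (σ : Sub n m n' m') T →
              subE s σ (renE s fromClosed T) ≡ renE s fromClosed T
subE-closed s σ T = trans (subE-renE s σ fromClosed T)
  (trans (subE-cong s ((λ ()) , (λ ())) T) (sym (renE-ι s fromClosed T)))

consʳ : Fin m' → Ren n m n' m' → Ren n (suc m) n' m'
consʳ a ρ = ren (Ren.onVar ρ) (a Vector.∷ Ren.onName ρ)

-- Rule `conc` forms its type by two renamings, of which the second alone does not respect
-- restriction; their composite does (`consʳ-ren`).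
instName-liftⁿ : ∀ s a (ρ : Ren n m n' m') T →
                 renE s (instName a) (renE s (liftⁿ ρ) T) ≡ renE s (consʳ a ρ) T
instName-liftⁿ s a ρ T = trans (renE-renE s (instName a) (liftⁿ ρ) T) (trans
  (subE-cong s ((λ _ → refl) , (λ { zero → refl ; (suc b) → refl })) T)
  (sym (renE-ι s (consʳ a ρ) T)))

-- Behind the cases `conc`, `＠-cong` and `＠-β` of the substitution lemmas. The hypothesis is the
-- square that `SubRel-restrict` delivers.
subE-instName : ∀ s {σ : Sub n₁ m₁ n₂ m₂} {ρ : Ren n m n₁ m₁}
                {ρ' : Ren n' m' n₂ m₂} {σ' : Sub n m n' m'} →
                σ ˢ∘ʳ ρ ≈ ρ' ʳ∘ˢ σ' → ∀ a T →
                subE s σ (renE s (instName a) (renE s (liftⁿ ρ) T)) ≡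
                renE s (instName (Sub.onName σ a)) (renE s (liftⁿ ρ') (subE s (liftˢⁿ σ') T))
subE-instName s {σ} {ρ} {ρ'} {σ'} e a T = begin
  subE s σ (renE s (instName a) (renE s (liftⁿ ρ) T))
    ≡⟨ cong (subE s σ) (instName-liftⁿ s a ρ T) ⟩
  subE s σ (renE s (consʳ a ρ) T)
    ≡⟨ subE-renE-comm s pointwise T ⟩
  renE s (consʳ (Sub.onName σ a) ρ') (subE s (liftˢⁿ σ') T)
    ≡⟨ sym (instName-liftⁿ s (Sub.onName σ a) ρ' _) ⟩
  renE s (instName (Sub.onName σ a)) (renE s (liftⁿ ρ') (subE s (liftˢⁿ σ') T)) ∎
  where
  open ≡-Reasoning
  pointwise : σ ˢ∘ʳ consʳ a ρ ≈ consʳ (Sub.onName σ a) ρ' ʳ∘ˢ liftˢⁿ σ'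
  pointwise =
    -- The entries of `liftˢⁿ σ'` are weakened by the new name, and on weakened objects `consʳ` acts
    -- as `ρ'`.
    (λ x → trans (_≈_.onVar e x) (trans (renObj-ι ρ' (Sub.onVar σ' x))
      (sym (renObj-renObj (consʳ (Sub.onName σ a) ρ') wkⁿ (Sub.onVar σ' x))))) ,
    (λ { zero → refl ; (suc b) → _≈_.onName e b })

-- Together with `renE-instName`: contracting a redex commutes with renaming, so the reduct of a
-- renamed redex is again a renamed object.
renE-instVar : ∀ s (ρ : Ren n m n' m') N T →
               renE s ρ (subE s (instVar N) T) ≡
               subE s (instVar (renObj ρ N)) (renE s (liftᵛ ρ) T)
renE-instVar s ρ N T = trans (renE-subE s ρ (instVar N) T) (trans
  (subE-cong s ((λ { zero → refl ; (suc x) → refl }) , (λ _ → refl)) T)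
  (sym (subE-renE s (instVar (renObj ρ N)) (liftᵛ ρ) T)))

renE-instName : ∀ s (ρ : Ren n m n' m') b T →
                renE s ρ (renE s (instName b) T) ≡
                renE s (instName (Ren.onName ρ b)) (renE s (liftⁿ ρ) T)
renE-instName s ρ b T = trans (renE-renE s ρ (instName b) T) (trans
  (subE-cong s ((λ _ → refl) , (λ { zero → refl ; (suc a) → refl })) T)
  (sym (renE-renE s (instName (Ren.onName ρ b)) (liftⁿ ρ) T)))

infixr 9 _ʳ∘ʳ_
_ʳ∘ʳ_ : Ren n₁ m₁ n₂ m₂ → Ren n m n₁ m₁ → Ren n m n₂ m₂
ρ ʳ∘ʳ ρ' = ren (Ren.onVar ρ ∘ Ren.onVar ρ') (Ren.onName ρ ∘ Ren.onName ρ')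

renObj-ʳ∘ʳ : ∀ (ρ : Ren n₁ m₁ n₂ m₂) (ρ' : Ren n m n₁ m₁) M →
             renObj ρ (renObj ρ' M) ≡ renObj (ρ ʳ∘ʳ ρ') M
renObj-ʳ∘ʳ ρ ρ' M = trans (renObj-renObj ρ ρ' M) (sym (renObj-ι (ρ ʳ∘ʳ ρ') M))

renObj-id : (M : Obj n m) → renObj (ren id id) M ≡ M
renObj-id M = trans (renObj-ι (ren id id) M) (subObj-id M)

-- The graph of renaming, which reduces the injectivity of renaming to a match
-- on the diagonal cases.
mutual
  data TyGraph (ρ : Ren n m n' m') : Ty n m → Ty n' m' → Set where
    con  : ∀ a → TyGraph ρ (con a) (con a)
    _·_  : ∀ {A A' M M'} → TyGraph ρ A A' → ObjGraph ρ M M' → TyGraph ρ (A · M) (A' · M')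
    Π    : ∀ {A A' B B'} → TyGraph ρ A A' → TyGraph (liftᵛ ρ) B B' → TyGraph ρ (Π A B) (Π A' B')
    name : ∀ α → TyGraph ρ (name α) (name α)
    New  : ∀ α {B B'} → TyGraph (liftⁿ ρ) B B' → TyGraph ρ (New α B) (New α B')

  data ObjGraph (ρ : Ren n m n' m') : Obj n m → Obj n' m' → Set where
    con  : ∀ c → ObjGraph ρ (con c) (con c)
    var  : ∀ {x y} → Ren.onVar ρ x ≡ y → ObjGraph ρ (var x) (var y)
    ƛ    : ∀ {A A' M M'} → TyGraph ρ A A' → ObjGraph (liftᵛ ρ) M M' → ObjGraph ρ (ƛ A M) (ƛ A' M')
    _·_  : ∀ {M M' N N'} → ObjGraph ρ M M' → ObjGraph ρ N N' → ObjGraph ρ (M · N) (M' · N')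
    name : ∀ {a b} → Ren.onName ρ a ≡ b → ObjGraph ρ (name a) (name b)
    ⟨_⟩_ : ∀ α {M M'} → ObjGraph (liftⁿ ρ) M M' → ObjGraph ρ (⟨ α ⟩ M) (⟨ α ⟩ M')
    _＠_  : ∀ {M M' a b} → ObjGraph ρ M M' → Ren.onName ρ a ≡ b → ObjGraph ρ (M ＠ a) (M' ＠ b)

mutual
  tyGraph : ∀ (ρ : Ren n m n' m') A → TyGraph ρ A (renTy ρ A)
  tyGraph ρ (con a)   = con a
  tyGraph ρ (A · M)   = tyGraph ρ A · objGraph ρ M
  tyGraph ρ (Π A B)   = Π (tyGraph ρ A) (tyGraph (liftᵛ ρ) B)
  tyGraph ρ (name α)  = name α
  tyGraph ρ (New α B) = New α (tyGraph (liftⁿ ρ) B)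

  objGraph : ∀ (ρ : Ren n m n' m') M → ObjGraph ρ M (renObj ρ M)
  objGraph ρ (con c)   = con c
  objGraph ρ (var x)   = var refl
  objGraph ρ (ƛ A M)   = ƛ (tyGraph ρ A) (objGraph (liftᵛ ρ) M)
  objGraph ρ (M · N)   = objGraph ρ M · objGraph ρ N
  objGraph ρ (name a)  = name refl
  objGraph ρ (⟨ α ⟩ M) = ⟨ α ⟩ objGraph (liftⁿ ρ) M
  objGraph ρ (M ＠ a)   = objGraph ρ M ＠ refl

record InjectiveRen (ρ : Ren n m n' m') : Set where
  field
    onVar  : ∀ {x y} → Ren.onVar ρ x ≡ Ren.onVar ρ y → x ≡ y
    onName : ∀ {a b} → Ren.onName ρ a ≡ Ren.onName ρ b → a ≡ b

lift-injective : {f : Fin n → Fin m} → (∀ {x y} → f x ≡ f y → x ≡ y) →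
                 ∀ {x y} → lift 1 f x ≡ lift 1 f y → x ≡ y
lift-injective inj {zero}  {zero}  e = refl
lift-injective inj {suc x} {suc y} e = cong suc (inj (suc-injective e))

liftᵛ-injective : {ρ : Ren n m n' m'} → InjectiveRen ρ → InjectiveRen (liftᵛ ρ)
liftᵛ-injective i = record { onVar = lift-injective onVar ; onName = onName }
  where open InjectiveRen i

liftⁿ-injective : {ρ : Ren n m n' m'} → InjectiveRen ρ → InjectiveRen (liftⁿ ρ)
liftⁿ-injective i = record { onVar = onVar ; onName = lift-injective onName }
  where open InjectiveRen i

mutual
  tyGraph-injective : {ρ : Ren n m n' m'} → InjectiveRen ρ → ∀ {A B C} →
                      TyGraph ρ A C → TyGraph ρ B C → A ≡ B
  tyGraph-injective i (con a)   (con .a)   = refl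
  tyGraph-injective i (A · M)   (B · N)    =
    cong₂ _·_ (tyGraph-injective i A B) (objGraph-injective i M N)
  tyGraph-injective i (Π A A')  (Π B B')   =
    cong₂ Π (tyGraph-injective i A B) (tyGraph-injective (liftᵛ-injective i) A' B')
  tyGraph-injective i (name α)  (name .α)  = refl
  tyGraph-injective i (New α A) (New .α B) =
    cong (New α) (tyGraph-injective (liftⁿ-injective i) A B)

  objGraph-injective : {ρ : Ren n m n' m'} → InjectiveRen ρ → ∀ {M N P} →
                       ObjGraph ρ M P → ObjGraph ρ N P → M ≡ N
  objGraph-injective i (con c)   (con .c)   = refl
  objGraph-injective i (var p)   (var q)    = cong var (InjectiveRen.onVar i (trans p (sym q)))
  objGraph-injective i (ƛ A M)   (ƛ B N)    =
    cong₂ ƛ (tyGraph-injective i A B) (objGraph-injective (liftᵛ-injective i) M N)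
  objGraph-injective i (M · M')  (N · N')   =
    cong₂ _·_ (objGraph-injective i M N) (objGraph-injective i M' N')
  objGraph-injective i (name p)  (name q)   = cong name (InjectiveRen.onName i (trans p (sym q)))
  objGraph-injective i (⟨ α ⟩ M) (⟨ .α ⟩ N) =
    cong (⟨ α ⟩_) (objGraph-injective (liftⁿ-injective i) M N)
  objGraph-injective i (M ＠ p)   (N ＠ q)    =
    cong₂ _＠_ (objGraph-injective i M N) (InjectiveRen.onName i (trans p (sym q)))

renObj-injective : {ρ : Ren n m n' m'} → InjectiveRen ρ → ∀ {M N} →
                   renObj ρ M ≡ renObj ρ N → M ≡ N
renObj-injective {ρ = ρ} i {M} {N} e =
  objGraph-injective i (objGraph ρ M) (subst (ObjGraph ρ N) (sym e) (objGraph ρ N))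

-- Restriction

module _ {T : ℕ → ℕ → Set} where

  -- Makes the preimage in rule `conc` unique, so that preimages found by typing and by the
  -- algorithm can be identified.
  emb-injective : {Γ : Cx T n m} {Γ' : Cx T n' m'} {a : Fin m} {α : NameTy}
                  (r : Γ ⊢ a ∶ α ╲ Γ') → InjectiveRen (emb r)
  emb-injective here      = record { onVar = id ; onName = suc-injective }
  emb-injective (skipⁿ r) = liftⁿ-injective (emb-injective r)
  emb-injective (skipᵛ r) = record { onVar = onVar ∘ suc-injective ; onName = onName }
    where open InjectiveRen (emb-injective r)

  -- Two restrictions by the same name have a priori different scopes, contexts and name types.
  -- Packing these with the derivation allows uniqueness to be one equation, and a match on `refl`
  -- then identifies the embeddings too.
  RestrictionOf : Cx T n m → Fin m → Set
  RestrictionOf Γ a =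
    Σ[ n' ∈ ℕ ] Σ[ m' ∈ ℕ ] Σ[ Γ' ∈ Cx T n' m' ] Σ[ α ∈ NameTy ] (Γ ⊢ a ∶ α ╲ Γ')

  restriction-unique : ∀ {Γ : Cx T n m} {a α β} {Γ₁ : Cx T n₁ m₁} {Γ₂ : Cx T n₂ m₂}
                       (r : Γ ⊢ a ∶ α ╲ Γ₁) (s : Γ ⊢ a ∶ β ╲ Γ₂) →
                       _≡_ {A = RestrictionOf Γ a}
                         (n₁ , m₁ , Γ₁ , α , r) (n₂ , m₂ , Γ₂ , β , s)
  restriction-unique here      here      = refl
  restriction-unique (skipⁿ r) (skipⁿ s) with refl ← restriction-unique r s = refl
  restriction-unique (skipᵛ r) (skipᵛ s) with refl ← restriction-unique r s = refl

  restriction⇒∋ⁿ : ∀ {Γ : Cx T n m} {a α} {Γ' : Cx T n' m'} → Γ ⊢ a ∶ α ╲ Γ' → Γ ∋ⁿ a ∶ α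
  restriction⇒∋ⁿ here      = here
  restriction⇒∋ⁿ (skipⁿ r) = skipⁿ (restriction⇒∋ⁿ r)
  restriction⇒∋ⁿ (skipᵛ r) = skipᵛ (restriction⇒∋ⁿ r)

  ∋ⁿ⇒restriction : ∀ {Γ : Cx T n m} {a α} → Γ ∋ⁿ a ∶ α →
                   Σ[ n' ∈ ℕ ] Σ[ m' ∈ ℕ ] Σ[ Γ' ∈ Cx T n' m' ] (Γ ⊢ a ∶ α ╲ Γ')
  ∋ⁿ⇒restriction here      = _ , _ , _ , here
  ∋ⁿ⇒restriction (skipⁿ i) = let _ , _ , _ , r = ∋ⁿ⇒restriction i in _ , _ , _ , skipⁿ r
  ∋ⁿ⇒restriction (skipᵛ i) = let _ , _ , _ , r = ∋ⁿ⇒restriction i in _ , _ , _ , skipᵛ r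

  -- A substitution may place the images of two names in either order, so restriction by one must be
  -- exchangeable with restriction by the other. Both orders end in the same `Γ₂` and embed it in
  -- `Γ` in the same way; only the indices of the two names change.
  record Commuted {Γ : Cx T n m} {Γ₁ : Cx T n₁ m₁} {Γ₂ : Cx T n₂ m₂} {a b α β}
                  (r : Γ ⊢ b ∶ β ╲ Γ₁) (s : Γ₁ ⊢ a ∶ α ╲ Γ₂) : Set where
    constructor commuted
    field
      {n₃ m₃} : ℕ
      {Γ₃}    : Cx T n₃ m₃
      {b'}    : Fin m₃
      s'      : Γ ⊢ Ren.onName (emb r) a ∶ α ╲ Γ₃
      r'      : Γ₃ ⊢ b' ∶ β ╲ Γ₂
      name≡   : Ren.onName (emb s') b' ≡ b
      onVar≡  : ∀ x → Ren.onVar (emb r) (Ren.onVar (emb s) x) ≡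
                      Ren.onVar (emb s') (Ren.onVar (emb r') x)
      onName≡ : ∀ c → Ren.onName (emb r) (Ren.onName (emb s) c) ≡
                      Ren.onName (emb s') (Ren.onName (emb r') c)

    emb≈ : ι (emb r) ˢ∘ʳ emb s ≈ ι (emb s') ˢ∘ʳ emb r'
    emb≈ = (λ x → cong var (onVar≡ x)) , onName≡

  commute : ∀ {Γ : Cx T n m} {Γ₁ : Cx T n₁ m₁} {Γ₂ : Cx T n₂ m₂} {a b α β}
            (r : Γ ⊢ b ∶ β ╲ Γ₁) (s : Γ₁ ⊢ a ∶ α ╲ Γ₂) → Commuted r s
  commute here      s         = commuted (skipⁿ s) here refl (λ _ → refl) (λ _ → refl)
  commute (skipⁿ r) here      = commuted here r refl (λ _ → refl) (λ _ → refl)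
  commute (skipⁿ r) (skipⁿ s) =
    let commuted s' r' e p q = commute r s
    in commuted (skipⁿ s') (skipⁿ r') (cong suc e) p
         (λ { zero → refl ; (suc a) → cong suc (q a) })
  commute (skipᵛ r) s         =
    let commuted s' r' e p q = commute r s
    in commuted (skipᵛ s') r' e (cong suc ∘ p) q

-- Substitutions between contexts

Pred : Set₁
Pred = ∀ {n m} → Ctx n m → Obj n m → Obj n m → Ty n m → Set

tailᵛ : Sub (suc n) m n' m' → Sub n m n' m'
tailᵛ σ = sub (Sub.onVar σ ∘ suc) (Sub.onName σ)

tailⁿ : Sub n (suc m) n' m' → Sub n m n' m'
tailⁿ σ = sub (Sub.onVar σ) (Sub.onName σ ∘ suc)

consⁿ : Fin m' → Sub n m n' m' → Sub n (suc m) n' m'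
consⁿ b σ = sub (Sub.onVar σ) (b Vector.∷ Sub.onName σ)

-- σ and τ are related by P at every variable and agree on names.  A predicate P
-- that ignores its second object gives the typing of σ alone.
-- Γ # α is only mapped into Δ if the part Γ is already mapped into the
-- restriction of Δ by the image of the new name: this is what makes related
-- substitutions compatible with restriction.
data SubRel (P : Pred) :
     Ctx n' m' → Sub n m n' m' → Sub n m n' m' → Ctx n m → Set where
  ∙     : ∀ {Δ : Ctx n' m'} {σ τ} → SubRel P Δ σ τ ∙
  _▸_   : ∀ {Δ : Ctx n' m'} {Γ : Ctx n m} {A σ τ} →
          SubRel P Δ (tailᵛ σ) (tailᵛ τ) Γ →
          P Δ (Sub.onVar σ zero) (Sub.onVar τ zero) (subTy (tailᵛ σ) A) →
          SubRel P Δ σ τ (Γ ▸ A)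
  named : ∀ {Δ : Ctx n' m'} {Δ' : Ctx n₁ m₁} {Γ : Ctx n m} {b α σ τ σ' τ'} →
          (r : Δ ⊢ b ∶ α ╲ Δ') → SubRel P Δ' σ' τ' Γ →
          Sub.onName σ zero ≡ b → Sub.onName τ zero ≡ b →
          tailⁿ σ ≈ emb r ʳ∘ˢ σ' → tailⁿ τ ≈ emb r ʳ∘ˢ τ' →
          SubRel P Δ σ τ (Γ # α)

coerceP : (P : Pred) {Δ : Ctx n m} → ∀ {M M' N N' A A'} →
          M ≡ M' → N ≡ N' → A ≡ A' → P Δ M N A → P Δ M' N' A'
coerceP P refl refl refl p = p

SubRel-≈ : ∀ {P : Pred} {Δ : Ctx n' m'} {Γ : Ctx n m} {σ σ' τ τ'} →
           SubRel P Δ σ τ Γ → σ ≈ σ' → τ ≈ τ' → SubRel P Δ σ' τ' Γ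
SubRel-≈ ∙ _ _ = ∙
SubRel-≈ {P = P} (_▸_ {A = A} s p) (v₁ , n₁) (v₂ , n₂) =
  SubRel-≈ s tail≈ (v₂ ∘ suc , n₂) ▸
  coerceP P (v₁ zero) (v₂ zero) (subTy-cong tail≈ A) p
  where tail≈ = (v₁ ∘ suc) , n₁
SubRel-≈ (named r s e₁ e₂ q₁ q₂) (v₁ , n₁) (v₂ , n₂) =
  named r s (trans (sym (n₁ zero)) e₁) (trans (sym (n₂ zero)) e₂)
    (≈-trans (sym ∘ v₁ , sym ∘ n₁ ∘ suc) q₁) (≈-trans (sym ∘ v₂ , sym ∘ n₂ ∘ suc) q₂)

-- The square of the exchange case of `SubRel-restrict`, which arises once for each of the two
-- substitutions. The newest name goes to `b'`, the position of `b` after the other name has been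
-- removed.
square-skipⁿ : ∀ {Δ : Ctx n' m'} {Δ₁ : Ctx n₁ m₁} {Δ₂ : Ctx n₂ m₂} {Γ : Ctx n m}
               {k l} {Γ' : Ctx k l} {a a' b α β σ₁ σ₂}
               {r : Δ ⊢ b ∶ β ╲ Δ₁} {r₁ : Δ₁ ⊢ a' ∶ α ╲ Δ₂}
               σ (t : Γ ⊢ a ∶ α ╲ Γ') (c : Commuted r r₁) → Sub.onName σ zero ≡ b →
               tailⁿ σ ≈ emb r ʳ∘ˢ σ₁ → σ₁ ˢ∘ʳ emb t ≈ emb r₁ ʳ∘ˢ σ₂ →
               σ ˢ∘ʳ liftⁿ (emb t) ≈
                 emb (Commuted.s' c) ʳ∘ˢ
                   consⁿ (Commuted.b' c) (emb (Commuted.r' c) ʳ∘ˢ σ₂)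
square-skipⁿ {σ₂ = σ₂} {r = r} σ t c e (v , n) (w , o) =
  (λ x → trans (v _) (trans (cong (renObj (emb r)) (w x))
           (renObj-square emb≈ (Sub.onVar σ₂ x)))) ,
  (λ { zero    → trans e (sym name≡)
     ; (suc a) → trans (n _) (trans (cong (Ren.onName (emb r)) (o a)) (onName≡ _)) })
  where open Commuted c

-- What it takes to carry related entries under binders and out of restrictions; `embed here` is
-- weakening by a name. The instances are variables, typed objects and equal objects, the latter two
-- resting on the renaming lemmas obtained from the first.
record Kit (P : Pred) : Set where
  field
    newest   : ∀ {Γ : Ctx n m} {A} → P (Γ ▸ A) (var zero) (var zero) (renTy wkᵛ A)
    weakenᵛ  : ∀ {Γ : Ctx n m} {M N A B} →
               P Γ M N A → P (Γ ▸ B) (renObj wkᵛ M) (renObj wkᵛ N) (renTy wkᵛ A)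
    embed    : ∀ {Γ : Ctx n m} {Γ' : Ctx n' m'} {a α M N A} (r : Γ ⊢ a ∶ α ╲ Γ') →
               P Γ' M N A → P Γ (renObj (emb r) M) (renObj (emb r) N) (renTy (emb r) A)

module SubRelOps {P : Pred} (kit : Kit P) where
  open Kit kit

  SubRel-weakenᵛ : ∀ {Δ : Ctx n' m'} {Γ : Ctx n m} {σ τ B} →
                   SubRel P Δ σ τ Γ → SubRel P (Δ ▸ B) (wkᵛ ʳ∘ˢ σ) (wkᵛ ʳ∘ˢ τ) Γ
  SubRel-weakenᵛ ∙ = ∙
  SubRel-weakenᵛ (_▸_ {A = A} {σ = σ} s p) =
    SubRel-weakenᵛ s ▸ coerceP P refl refl (renTy-subTy wkᵛ (tailᵛ σ) A) (weakenᵛ p)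
  SubRel-weakenᵛ {B = B} (named {σ' = σ'} {τ' = τ'} r s e₁ e₂ (v₁ , n₁) (v₂ , n₂)) =
    -- The new variable is declared after `b`, so restriction by `b` drops it and `s` is kept
    -- unchanged.
    named (skipᵛ r) s e₁ e₂
      ((λ x → trans (cong (renObj wkᵛ) (v₁ x)) (renObj-comp (Sub.onVar σ' x))) , n₁)
      ((λ x → trans (cong (renObj wkᵛ) (v₂ x)) (renObj-comp (Sub.onVar τ' x))) , n₂)
    where
    renObj-comp : ∀ M → renObj wkᵛ (renObj (emb r) M) ≡ renObj (emb (skipᵛ {A = B} r)) M
    renObj-comp M = trans (renObj-renObj wkᵛ (emb r) M)
      (sym (renObj-ι (emb (skipᵛ {A = B} r)) M))

  SubRel-weakenⁿ : ∀ {Δ : Ctx n' m'} {Γ : Ctx n m} {σ τ β} →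
                   SubRel P Δ σ τ Γ → SubRel P (Δ # β) (wkⁿ ʳ∘ˢ σ) (wkⁿ ʳ∘ˢ τ) Γ
  SubRel-weakenⁿ ∙ = ∙
  SubRel-weakenⁿ (_▸_ {A = A} {σ = σ} s p) =
    SubRel-weakenⁿ s ▸ coerceP P refl refl (renTy-subTy wkⁿ (tailᵛ σ) A) (embed here p)
  SubRel-weakenⁿ (named {σ' = σ'} {τ' = τ'} r s e₁ e₂ (v₁ , n₁) (v₂ , n₂)) =
    -- A new name, unlike a new variable, survives restriction by `b`, so `s` has to be weakened as
    -- well.
    named (skipⁿ r) (SubRel-weakenⁿ s) (cong suc e₁) (cong suc e₂)
      ((λ x → trans (cong (renObj wkⁿ) (v₁ x)) (renObj-square ≈-refl (Sub.onVar σ' x))) ,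
       cong suc ∘ n₁)
      ((λ x → trans (cong (renObj wkⁿ) (v₂ x)) (renObj-square ≈-refl (Sub.onVar τ' x))) ,
       cong suc ∘ n₂)

  SubRel-liftᵛ : ∀ {Δ : Ctx n' m'} {Γ : Ctx n m} {σ τ} A → SubRel P Δ σ τ Γ →
                 SubRel P (Δ ▸ subTy σ A) (liftˢᵛ σ) (liftˢᵛ τ) (Γ ▸ A)
  SubRel-liftᵛ {σ = σ} A s =
    SubRel-weakenᵛ s ▸ coerceP P refl refl (renTy-subTy wkᵛ σ A) newest

  SubRel-liftⁿ : ∀ {Δ : Ctx n' m'} {Γ : Ctx n m} {σ τ α} → SubRel P Δ σ τ Γ →
                 SubRel P (Δ # α) (liftˢⁿ σ) (liftˢⁿ τ) (Γ # α)
  SubRel-liftⁿ s = named here s refl refl ≈-refl ≈-refl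

  SubRel-id : (Γ : Ctx n m) → SubRel P Γ idˢ idˢ Γ
  SubRel-id ∙       = ∙
  SubRel-id (Γ ▸ A) =
    subst (λ B → SubRel P (Γ ▸ B) idˢ idˢ (Γ ▸ A)) (subTy-id A)
      (SubRel-≈ (SubRel-liftᵛ A (SubRel-id Γ)) liftˢᵛ-id liftˢᵛ-id)
  SubRel-id (Γ # α) = SubRel-≈ (SubRel-liftⁿ (SubRel-id Γ)) liftˢⁿ-id liftˢⁿ-id

  SubRel-inst : ∀ {Γ : Ctx n m} {M N A} → P Γ M N A →
                SubRel P Γ (instVar M) (instVar N) (Γ ▸ A)
  SubRel-inst {Γ = Γ} {A = A} p =
    SubRel-id Γ ▸ coerceP P refl refl (sym (subTy-id A)) p

  SubRel-lookup : ∀ {Δ : Ctx n' m'} {Γ : Ctx n m} {σ τ x A} → SubRel P Δ σ τ Γ →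
                  Γ ∋ x ∶ A → P Δ (Sub.onVar σ x) (Sub.onVar τ x) (subTy σ A)
  SubRel-lookup {σ = σ} (s ▸ p) (here {A = A}) =
    coerceP P refl refl (sym (subTy-renTy σ wkᵛ A)) p
  SubRel-lookup {σ = σ} (s ▸ p) (skipᵛ {A = A} i) =
    coerceP P refl refl (sym (subTy-renTy σ wkᵛ A)) (SubRel-lookup s i)
  SubRel-lookup {σ = σ} (named r s e₁ e₂ q₁ q₂) (skipⁿ {x = x} {A = A} i) =
    coerceP P (sym (_≈_.onVar q₁ x)) (sym (_≈_.onVar q₂ x))
      (sym (subE-renE-comm ty q₁ A)) (embed r (SubRel-lookup s i))

  -- The image `a'` is a field of its own because a single restriction of `Δ` has to serve both `σ`
  -- and `τ`.
  record Restricted (Δ : Ctx n' m') (σ τ : Sub n m n' m') {Γ : Ctx n m} {Γ' : Ctx n₁ m₁}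
                    {a α} (r : Γ ⊢ a ∶ α ╲ Γ') : Set where
    constructor restricted
    field
      {n₃ m₃} : ℕ
      {Δ'}    : Ctx n₃ m₃
      {a'}    : Fin m'
      {σ' τ'} : Sub n₁ m₁ n₃ m₃
      r'      : Δ ⊢ a' ∶ α ╲ Δ'
      rel     : SubRel P Δ' σ' τ' Γ'
      nameˡ   : Sub.onName σ a ≡ a'
      nameʳ   : Sub.onName τ a ≡ a'
      squareˡ : σ ˢ∘ʳ emb r ≈ emb r' ʳ∘ˢ σ'
      squareʳ : τ ˢ∘ʳ emb r ≈ emb r' ʳ∘ˢ τ'

  -- For the newest name this is the content of `named`. For an older one the recursive result lies
  -- over a target already restricted by the newest name's image, and `commute` exchanges the two
  -- restrictions.
  SubRel-restrict : ∀ {Δ : Ctx n' m'} {Γ : Ctx n m} {Γ' : Ctx n₁ m₁} {σ τ a α} →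
                    SubRel P Δ σ τ Γ → (r : Γ ⊢ a ∶ α ╲ Γ') → Restricted Δ σ τ r
  SubRel-restrict (s ▸ p) (skipᵛ t) =
    let restricted r' s' e₁ e₂ q₁ q₂ = SubRel-restrict s t
    in restricted r' s' e₁ e₂ (_≈_.onVar q₁ , _≈_.onName q₁) (_≈_.onVar q₂ , _≈_.onName q₂)
  SubRel-restrict (named r s e₁ e₂ q₁ q₂) here =
    restricted r s e₁ e₂ (_≈_.onVar q₁ , _≈_.onName q₁) (_≈_.onVar q₂ , _≈_.onName q₂)
  SubRel-restrict {σ = σ} {τ} (named r s e₁ e₂ q₁ q₂) (skipⁿ {a = a} t) =
    let restricted r₁ s₁ f₁ f₂ g₁ g₂ = SubRel-restrict s t
        c = commute r r₁
        open Commuted c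
    in restricted s' (named r' s₁ refl refl ≈-refl ≈-refl)
         (trans (_≈_.onName q₁ a) (cong (Ren.onName (emb r)) f₁))
         (trans (_≈_.onName q₂ a) (cong (Ren.onName (emb r)) f₂))
         (square-skipⁿ σ t c e₁ q₁ g₁) (square-skipⁿ τ t c e₂ q₂ g₂)

  SubRel-name : ∀ {Δ : Ctx n' m'} {Γ : Ctx n m} {σ τ a α} → SubRel P Δ σ τ Γ →
                Γ ∋ⁿ a ∶ α → Δ ∋ⁿ Sub.onName σ a ∶ α
  SubRel-name {Δ = Δ} s i =
    let _ , _ , _ , r = ∋ⁿ⇒restriction i
        restricted r' _ e _ _ _ = SubRel-restrict s r
    in subst (Δ ∋ⁿ_∶ _) (sym e) (restriction⇒∋ⁿ r')

-- Erasure

renTy⁻ : ∀ (ρ : Ren n m n' m') A → renTy ρ A ⁻ ≡ A ⁻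
renTy⁻ ρ (con a)   = refl
renTy⁻ ρ (A · M)   = renTy⁻ ρ A
renTy⁻ ρ (Π A B)   = cong₂ _⇒_ (renTy⁻ ρ A) (renTy⁻ (liftᵛ ρ) B)
renTy⁻ ρ (name α)  = refl
renTy⁻ ρ (New α B) = cong (⟨ α ⟩ˢ_) (renTy⁻ (liftⁿ ρ) B)

subTy⁻ : ∀ (σ : Sub n m n' m') A → subTy σ A ⁻ ≡ A ⁻
subTy⁻ σ (con a)   = refl
subTy⁻ σ (A · M)   = subTy⁻ σ A
subTy⁻ σ (Π A B)   = cong₂ _⇒_ (subTy⁻ σ A) (subTy⁻ (liftˢᵛ σ) B)
subTy⁻ σ (name α)  = refl
subTy⁻ σ (New α B) = cong (⟨ α ⟩ˢ_) (subTy⁻ (liftˢⁿ σ) B)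

eraseʳ : ∀ {Γ : Ctx n m} {Γ' : Ctx n' m'} {a α} → Γ ⊢ a ∶ α ╲ Γ' → Γ ⁻ᶜ ⊢ a ∶ α ╲ Γ' ⁻ᶜ
eraseʳ here      = here
eraseʳ (skipⁿ r) = skipⁿ (eraseʳ r)
eraseʳ (skipᵛ r) = skipᵛ (eraseʳ r)

emb-eraseʳ : ∀ {Γ : Ctx n m} {Γ' : Ctx n' m'} {a α} (r : Γ ⊢ a ∶ α ╲ Γ') →
             emb (eraseʳ r) ≡ emb r
emb-eraseʳ here      = refl
emb-eraseʳ (skipⁿ r) = cong liftⁿ (emb-eraseʳ r)
emb-eraseʳ (skipᵛ r) = cong (λ ρ → ren (suc ∘ Ren.onVar ρ) (Ren.onName ρ)) (emb-eraseʳ r)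

emb-erased-injective : ∀ {Γ : Ctx n m} {Γ' : Ctx n' m'} {a α M N} (r : Γ ⊢ a ∶ α ╲ Γ') →
                       renObj (emb (eraseʳ r)) M ≡ renObj (emb r) N → M ≡ N
emb-erased-injective {M = M} r e = renObj-injective (emb-injective r)
  (trans (cong (λ ρ → renObj ρ M) (sym (emb-eraseʳ r))) e)

∋-unique : ∀ {Γ : Ctx n m} {x A B} → Γ ∋ x ∶ A → Γ ∋ x ∶ B → A ≡ B
∋-unique here      here      = refl
∋-unique (skipⁿ i) (skipⁿ j) = cong (renTy wkⁿ) (∋-unique i j)
∋-unique (skipᵛ i) (skipᵛ j) = cong (renTy wkᵛ) (∋-unique i j)

∋ⁿ-unique : ∀ {T} {Γ : Cx T n m} {a α β} → Γ ∋ⁿ a ∶ α → Γ ∋ⁿ a ∶ β → α ≡ β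
∋ⁿ-unique here      here      = refl
∋ⁿ-unique (skipⁿ i) (skipⁿ j) = ∋ⁿ-unique i j
∋ⁿ-unique (skipᵛ i) (skipᵛ j) = ∋ⁿ-unique i j

∋ⁿ-erase : ∀ {Γ : Ctx n m} {a α} → Γ ∋ⁿ a ∶ α → Γ ⁻ᶜ ∋ⁿ a ∶ α
∋ⁿ-erase here      = here
∋ⁿ-erase (skipⁿ i) = skipⁿ (∋ⁿ-erase i)
∋ⁿ-erase (skipᵛ i) = skipᵛ (∋ⁿ-erase i)

∋-erase : ∀ {Γ : Ctx n m} {x A τ} → Γ ∋ x ∶ A → Γ ⁻ᶜ ∋ˢ x ∶ τ → A ⁻ ≡ τ
∋-erase (here {A = A})      here      = renTy⁻ wkᵛ A
∋-erase (skipⁿ {A = A} i) (skipⁿ j) = trans (renTy⁻ wkⁿ A) (∋-erase i j)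
∋-erase (skipᵛ {A = A} i) (skipᵛ j) = trans (renTy⁻ wkᵛ A) (∋-erase i j)

-- Signatures and substitution

-- Each classifier was checked over the declarations older than it; this transports the check to the
-- whole signature.
module SigWeakening {Σ₀ Σ₁ : Sig} (Σ₀⊆Σ₁ : ∀ {d} → d ∈ Σ₀ → d ∈ Σ₁) where
  private
    module J₀ = Judgments Σ₀
    module J₁ = Judgments Σ₁

  mutual
    weaken-kind : {Γ : Ctx n m} → ∀ {K} → Γ J₀.⊢ K kind → Γ J₁.⊢ K kind
    weaken-kind J₀.type    = J₁.type
    weaken-kind (J₀.Π A K) = J₁.Π (weaken-type A) (weaken-kind K)

    weaken-type : {Γ : Ctx n m} → ∀ {A K} → Γ J₀.⊢ᵗ A ∶ K → Γ J₁.⊢ᵗ A ∶ K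
    weaken-type (J₀.con i)    = J₁.con (Σ₀⊆Σ₁ i)
    weaken-type (J₀.app A M)  = J₁.app (weaken-type A) (weaken-obj M)
    weaken-type (J₀.Π A B)    = J₁.Π (weaken-type A) (weaken-type B)
    weaken-type (J₀.name i)   = J₁.name (Σ₀⊆Σ₁ i)
    weaken-type (J₀.New i B)  = J₁.New (Σ₀⊆Σ₁ i) (weaken-type B)
    weaken-type (J₀.conv A e) = J₁.conv (weaken-type A) (weaken-kind≐ e)

    weaken-obj : {Γ : Ctx n m} → ∀ {M A} → Γ J₀.⊢ M ∶ A → Γ J₁.⊢ M ∶ A
    weaken-obj (J₀.con i)    = J₁.con (Σ₀⊆Σ₁ i)
    weaken-obj (J₀.var i)    = J₁.var i
    weaken-obj (J₀.name i)   = J₁.name i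
    weaken-obj (J₀.lam A M)  = J₁.lam (weaken-type A) (weaken-obj M)
    weaken-obj (J₀.app M N)  = J₁.app (weaken-obj M) (weaken-obj N)
    weaken-obj (J₀.abs i M)  = J₁.abs (Σ₀⊆Σ₁ i) (weaken-obj M)
    weaken-obj (J₀.conc r M) = J₁.conc r (weaken-obj M)
    weaken-obj (J₀.conv M e) = J₁.conv (weaken-obj M) (weaken-type≐ e)

    weaken-kind≐ : {Γ : Ctx n m} → ∀ {K L} → Γ J₀.⊢ᵏ K ≐ L → Γ J₁.⊢ᵏ K ≐ L
    weaken-kind≐ (J₀.sym e)        = J₁.sym (weaken-kind≐ e)
    weaken-kind≐ (J₀.trans e f)    = J₁.trans (weaken-kind≐ e) (weaken-kind≐ f)
    weaken-kind≐ J₀.type           = J₁.type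
    weaken-kind≐ (J₀.Π-cong A e f) =
      J₁.Π-cong (weaken-type A) (weaken-type≐ e) (weaken-kind≐ f)

    weaken-type≐ : {Γ : Ctx n m} → ∀ {A B K} → Γ J₀.⊢ᵗ A ≐ B ∶ K → Γ J₁.⊢ᵗ A ≐ B ∶ K
    weaken-type≐ (J₀.sym e)        = J₁.sym (weaken-type≐ e)
    weaken-type≐ (J₀.trans e f)    = J₁.trans (weaken-type≐ e) (weaken-type≐ f)
    weaken-type≐ (J₀.conv e f)     = J₁.conv (weaken-type≐ e) (weaken-kind≐ f)
    weaken-type≐ (J₀.con i)        = J₁.con (Σ₀⊆Σ₁ i)
    weaken-type≐ (J₀.app-cong e f) = J₁.app-cong (weaken-type≐ e) (weaken-obj≐ f)
    weaken-type≐ (J₀.Π-cong A e f) =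
      J₁.Π-cong (weaken-type A) (weaken-type≐ e) (weaken-type≐ f)
    weaken-type≐ (J₀.tyExt B e)    = J₁.tyExt (weaken-type B) (weaken-type≐ e)
    weaken-type≐ (J₀.name i)       = J₁.name (Σ₀⊆Σ₁ i)
    weaken-type≐ (J₀.New-cong i e) = J₁.New-cong (Σ₀⊆Σ₁ i) (weaken-type≐ e)

    weaken-obj≐ : {Γ : Ctx n m} → ∀ {M N A} → Γ J₀.⊢ M ≐ N ∶ A → Γ J₁.⊢ M ≐ N ∶ A
    weaken-obj≐ (J₀.sym e)            = J₁.sym (weaken-obj≐ e)
    weaken-obj≐ (J₀.trans e f)        = J₁.trans (weaken-obj≐ e) (weaken-obj≐ f)
    weaken-obj≐ (J₀.conv e f)         = J₁.conv (weaken-obj≐ e) (weaken-type≐ f)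
    weaken-obj≐ (J₀.var i)            = J₁.var i
    weaken-obj≐ (J₀.con i)            = J₁.con (Σ₀⊆Σ₁ i)
    weaken-obj≐ (J₀.app-cong e f)     = J₁.app-cong (weaken-obj≐ e) (weaken-obj≐ f)
    weaken-obj≐ (J₀.ƛ-cong A e e' f)  =
      J₁.ƛ-cong (weaken-type A) (weaken-type≐ e) (weaken-type≐ e') (weaken-obj≐ f)
    weaken-obj≐ (J₀.β A e f)          = J₁.β (weaken-type A) (weaken-obj≐ e) (weaken-obj≐ f)
    weaken-obj≐ (J₀.ext A M N e)      =
      J₁.ext (weaken-type A) (weaken-obj M) (weaken-obj N) (weaken-obj≐ e)
    weaken-obj≐ (J₀.name i)           = J₁.name i
    weaken-obj≐ (J₀.⟨⟩-cong i e)      = J₁.⟨⟩-cong (Σ₀⊆Σ₁ i) (weaken-obj≐ e)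
    weaken-obj≐ (J₀.＠-cong r e)       = J₁.＠-cong r (weaken-obj≐ e)
    weaken-obj≐ (J₀.＠-β r e)          = J₁.＠-β r (weaken-obj≐ e)
    weaken-obj≐ (J₀.newExt i e)       = J₁.newExt (Σ₀⊆Σ₁ i) (weaken-obj≐ e)

∈⇒type : ∀ {Σ c A} → ⊢ Σ sig → (c ∶ᵒ A) ∈ Σ → (let open Judgments Σ in ∙ ⊢ᵗ A ∶ type)
∈⇒type (objD s _ A) (here refl) = SigWeakening.weaken-type there A
∈⇒type (objD s _ _) (there i)   = SigWeakening.weaken-type there (∈⇒type s i)
∈⇒type (tyD s _ _)  (there i)   = SigWeakening.weaken-type there (∈⇒type s i)
∈⇒type (nameD s _)  (there i)   = SigWeakening.weaken-type there (∈⇒type s i)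

∈⇒kind : ∀ {Σ a K} → ⊢ Σ sig → (a ∶ᵗ K) ∈ Σ → (let open Judgments Σ in ∙ ⊢ K kind)
∈⇒kind (tyD s _ K)  (here refl) = SigWeakening.weaken-kind there K
∈⇒kind (objD s _ _) (there i)   = SigWeakening.weaken-kind there (∈⇒kind s i)
∈⇒kind (tyD s _ _)  (there i)   = SigWeakening.weaken-kind there (∈⇒kind s i)
∈⇒kind (nameD s _)  (there i)   = SigWeakening.weaken-kind there (∈⇒kind s i)

∈-unique : ∀ {Σ c A B} → ⊢ Σ sig → (c ∶ᵒ A) ∈ Σ → (c ∶ᵒ B) ∈ Σ → A ≡ B
∈-unique _              (here refl) (here refl) = refl
∈-unique (objD _ new _) (here refl) (there j)   = ⊥-elim (new _ j)
∈-unique (objD _ new _) (there i)   (here refl) = ⊥-elim (new _ i)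
∈-unique (objD s _ _)   (there i)   (there j)   = ∈-unique s i j
∈-unique (tyD s _ _)    (there i)   (there j)   = ∈-unique s i j
∈-unique (nameD s _)    (there i)   (there j)   = ∈-unique s i j

module Metatheory (Σ : Sig) where
  open Judgments Σ renaming (sym to ≐-sym; trans to ≐-trans)

  -- Reflexivity of definitional equality

  mutual
    -- Equality has no reflexivity rule, but every formation rule has a congruence to match it.
    kind-refl : {Γ : Ctx n m} → ∀ {K} → Γ ⊢ K kind → Γ ⊢ᵏ K ≐ K
    kind-refl type    = type
    kind-refl (Π A K) = Π-cong A (type-refl A) (kind-refl K)

    type-refl : {Γ : Ctx n m} → ∀ {A K} → Γ ⊢ᵗ A ∶ K → Γ ⊢ᵗ A ≐ A ∶ K
    type-refl (con i)    = con i
    type-refl (app A M)  = app-cong (type-refl A) (obj-refl M)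
    type-refl (Π A B)    = Π-cong A (type-refl A) (type-refl B)
    type-refl (name i)   = name i
    type-refl (New i B)  = New-cong i (type-refl B)
    -- Conversion takes the kind equation from new to old in typing, but from old to new in
    -- equality.
    type-refl (conv A e) = conv (type-refl A) (≐-sym e)

    obj-refl : {Γ : Ctx n m} → ∀ {M A} → Γ ⊢ M ∶ A → Γ ⊢ M ≐ M ∶ A
    obj-refl (con i)    = con i
    obj-refl (var i)    = var i
    obj-refl (name i)   = name i
    obj-refl (lam A M)  = ƛ-cong A (type-refl A) (type-refl A) (obj-refl M)
    obj-refl (app M N)  = app-cong (obj-refl M) (obj-refl N)
    obj-refl (abs i M)  = ⟨⟩-cong i (obj-refl M)
    obj-refl (conc r M) = ＠-cong r (obj-refl M)
    obj-refl (conv M e) = conv (obj-refl M) e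

  coeᵗ : {Γ : Ctx n m} → ∀ {A K L} → K ≡ L → Γ ⊢ᵗ A ∶ K → Γ ⊢ᵗ A ∶ L
  coeᵗ refl A = A

  coe : {Γ : Ctx n m} → ∀ {M N A B} → M ≡ N → A ≡ B → Γ ⊢ M ∶ A → Γ ⊢ N ∶ B
  coe refl refl M = M

  coeᵗ≐ : {Γ : Ctx n m} → ∀ {A A' B B' K L} → A ≡ A' → B ≡ B' → K ≡ L →
          Γ ⊢ᵗ A ≐ B ∶ K → Γ ⊢ᵗ A' ≐ B' ∶ L
  coeᵗ≐ refl refl refl e = e

  coe≐ : {Γ : Ctx n m} → ∀ {M M' N N' A B} → M ≡ M' → N ≡ N' → A ≡ B →
         Γ ⊢ M ≐ N ∶ A → Γ ⊢ M' ≐ N' ∶ B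
  coe≐ refl refl refl e = e

  -- Preservation of all judgments under substitution

  module Substitution {P : Pred} (kit : Kit P)
           (⌊_⌋ : ∀ {n m} {Γ : Ctx n m} {M N A} → P Γ M N A → Γ ⊢ M ∶ A) where
    open SubRelOps kit

    mutual
      -- Generic in `P`, so that one induction covers renamings, typed substitutions and the left
      -- member of a related pair.
      sub-kind : ∀ {Δ : Ctx n' m'} {Γ : Ctx n m} {σ τ K} → SubRel P Δ σ τ Γ →
                 Γ ⊢ K kind → Δ ⊢ subKind σ K kind
      sub-kind s type    = type
      sub-kind s (Π A K) = Π (sub-type s A) (sub-kind (SubRel-liftᵛ _ s) K)

      sub-type : ∀ {Δ : Ctx n' m'} {Γ : Ctx n m} {σ τ A K} → SubRel P Δ σ τ Γ →
                 Γ ⊢ᵗ A ∶ K → Δ ⊢ᵗ subTy σ A ∶ subKind σ K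
      sub-type s (con {K = K} i) = coeᵗ (sym (subE-closed kind _ K)) (con i)
      sub-type s (app {M = M} {K = K} A N) =
        coeᵗ (sym (subE-instVar kind _ M K)) (app (sub-type s A) (sub-obj s N))
      sub-type s (Π A B)    = Π (sub-type s A) (sub-type (SubRel-liftᵛ _ s) B)
      sub-type s (name i)   = name i
      sub-type s (New i B)  = New i (sub-type (SubRel-liftⁿ s) B)
      sub-type s (conv A e) = conv (sub-type s A) (sub-kind≐ s e)

      sub-obj : ∀ {Δ : Ctx n' m'} {Γ : Ctx n m} {σ τ M A} → SubRel P Δ σ τ Γ →
                Γ ⊢ M ∶ A → Δ ⊢ subObj σ M ∶ subTy σ A
      sub-obj s (con {A = A} i) = coe refl (sym (subE-closed ty _ A)) (con i)
      sub-obj s (var i)    = ⌊ SubRel-lookup s i ⌋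
      sub-obj s (name i)   = name (SubRel-name s i)
      sub-obj s (lam A M)  = lam (sub-type s A) (sub-obj (SubRel-liftᵛ _ s) M)
      sub-obj s (app {N = N} {B = B} L O) =
        coe refl (sym (subE-instVar ty _ N B)) (app (sub-obj s L) (sub-obj s O))
      sub-obj s (abs i M)  = abs i (sub-obj (SubRel-liftⁿ s) M)
      sub-obj {σ = σ} s (conc {a = a} {M = M} {B = B} r N)
        with restricted r' s' e _ q _ ← SubRel-restrict s r =
        coe (cong₂ _＠_ (sym (subE-renE-comm obj q M)) (sym e))
          (trans (cong (renTy _ _ [_]ⁿᵗ) (sym e)) (sym (subE-instName ty q a B)))
          (conc r' (sub-obj s' N))
      sub-obj s (conv M e) = conv (sub-obj s M) (sub-type≐ s e)

      sub-kind≐ : ∀ {Δ : Ctx n' m'} {Γ : Ctx n m} {σ τ K L} → SubRel P Δ σ τ Γ →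
                  Γ ⊢ᵏ K ≐ L → Δ ⊢ᵏ subKind σ K ≐ subKind σ L
      sub-kind≐ s (≐-sym e)      = ≐-sym (sub-kind≐ s e)
      sub-kind≐ s (≐-trans e f)  = ≐-trans (sub-kind≐ s e) (sub-kind≐ s f)
      sub-kind≐ s type           = type
      sub-kind≐ s (Π-cong A e f) =
        Π-cong (sub-type s A) (sub-type≐ s e) (sub-kind≐ (SubRel-liftᵛ _ s) f)

      sub-type≐ : ∀ {Δ : Ctx n' m'} {Γ : Ctx n m} {σ τ A B K} → SubRel P Δ σ τ Γ →
                  Γ ⊢ᵗ A ≐ B ∶ K → Δ ⊢ᵗ subTy σ A ≐ subTy σ B ∶ subKind σ K
      sub-type≐ s (≐-sym e)      = ≐-sym (sub-type≐ s e)
      sub-type≐ s (≐-trans e f)  = ≐-trans (sub-type≐ s e) (sub-type≐ s f)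
      sub-type≐ s (conv e f)     = conv (sub-type≐ s e) (sub-kind≐ s f)
      sub-type≐ s (con {K = K} i) = coeᵗ≐ refl refl (sym (subE-closed kind _ K)) (con i)
      sub-type≐ s (app-cong {M = M} {K = K} e f) =
        coeᵗ≐ refl refl (sym (subE-instVar kind _ M K)) (app-cong (sub-type≐ s e) (sub-obj≐ s f))
      sub-type≐ s (Π-cong A e f) =
        Π-cong (sub-type s A) (sub-type≐ s e) (sub-type≐ (SubRel-liftᵛ _ s) f)
      sub-type≐ s (tyExt {A₁ = A₁} {A₂} B e) = tyExt (sub-type s B)
        (coeᵗ≐ (cong (_· var zero) (subE-wkᵛ ty _ A₁)) (cong (_· var zero) (subE-wkᵛ ty _ A₂))
          refl (sub-type≐ (SubRel-liftᵛ _ s) e))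
      sub-type≐ s (name i)       = name i
      sub-type≐ s (New-cong i e) = New-cong i (sub-type≐ (SubRel-liftⁿ s) e)

      sub-obj≐ : ∀ {Δ : Ctx n' m'} {Γ : Ctx n m} {σ τ M N A} → SubRel P Δ σ τ Γ →
                 Γ ⊢ M ≐ N ∶ A → Δ ⊢ subObj σ M ≐ subObj σ N ∶ subTy σ A
      sub-obj≐ s (≐-sym e)     = ≐-sym (sub-obj≐ s e)
      sub-obj≐ s (≐-trans e f) = ≐-trans (sub-obj≐ s e) (sub-obj≐ s f)
      sub-obj≐ s (conv e f)    = conv (sub-obj≐ s e) (sub-type≐ s f)
      sub-obj≐ s (var i)       = obj-refl ⌊ SubRel-lookup s i ⌋
      sub-obj≐ s (con {A = A} i) = coe≐ refl refl (sym (subE-closed ty _ A)) (con i)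
      sub-obj≐ s (app-cong {M₂ = N} {B = B} e f) =
        coe≐ refl refl (sym (subE-instVar ty _ N B)) (app-cong (sub-obj≐ s e) (sub-obj≐ s f))
      sub-obj≐ s (ƛ-cong A e e' f) =
        ƛ-cong (sub-type s A) (sub-type≐ s e) (sub-type≐ s e') (sub-obj≐ (SubRel-liftᵛ _ s) f)
      sub-obj≐ s (β {B = B} {M₁ = M₁} {N₁ = N₁} {N₂ = N₂} A e f) =
        coe≐ refl (sym (subE-instVar obj _ N₁ N₂)) (sym (subE-instVar ty _ M₁ B))
          (β (sub-type s A) (sub-obj≐ (SubRel-liftᵛ _ s) e) (sub-obj≐ s f))
      sub-obj≐ s (ext {M = M} {N} A M∶ N∶ e) =
        ext (sub-type s A) (sub-obj s M∶) (sub-obj s N∶)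
          (coe≐ (cong (_· var zero) (subE-wkᵛ obj _ M)) (cong (_· var zero) (subE-wkᵛ obj _ N))
            refl (sub-obj≐ (SubRel-liftᵛ _ s) e))
      sub-obj≐ s (name i)      = name (SubRel-name s i)
      sub-obj≐ s (⟨⟩-cong i e) = ⟨⟩-cong i (sub-obj≐ (SubRel-liftⁿ s) e)
      sub-obj≐ s (＠-cong {b = b} {M = M} {N} {A} r e)
        with restricted r' s' h _ q _ ← SubRel-restrict s r =
        coe≐ (cong₂ _＠_ (sym (subE-renE-comm obj q M)) (sym h))
          (cong₂ _＠_ (sym (subE-renE-comm obj q N)) (sym h))
          (trans (cong (renTy _ _ [_]ⁿᵗ) (sym h)) (sym (subE-instName ty q b A)))
          (＠-cong r' (sub-obj≐ s' e))
      sub-obj≐ s (＠-β {b = b} {M = M} {N} {A} r e)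
        with restricted r' s' h _ q _ ← SubRel-restrict s r =
        coe≐ (cong₂ _＠_ (sym (subE-renE-comm obj q (⟨ _ ⟩ M))) (sym h))
          (trans (cong (renObj _ _ [_]ⁿ) (sym h)) (sym (subE-instName obj q b N)))
          (trans (cong (renTy _ _ [_]ⁿᵗ) (sym h)) (sym (subE-instName ty q b A)))
          (＠-β r' (sub-obj≐ (SubRel-liftⁿ s') e))
      sub-obj≐ s (newExt {M = M} {N} i e) = newExt i
        (coe≐ (cong (_＠ zero) (subE-wkⁿ obj _ M)) (cong (_＠ zero) (subE-wkⁿ obj _ N))
          refl (sub-obj≐ (SubRel-liftⁿ s) e))

  -- Renaming

  data Variable {n m} (Γ : Ctx n m) : Obj n m → Obj n m → Ty n m → Set where
    var : ∀ {x A} → Γ ∋ x ∶ A → Variable Γ (var x) (var x) A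

  emb-∋ : ∀ {Γ : Ctx n m} {Γ' : Ctx n' m'} {a α x A} (r : Γ ⊢ a ∶ α ╲ Γ') →
          Γ' ∋ x ∶ A → Γ ∋ Ren.onVar (emb r) x ∶ renTy (emb r) A
  emb-∋ here      i                 = skipⁿ i
  emb-∋ (skipⁿ {Γ = Γ} r) (skipⁿ {A = A} i) =
    subst (Γ # _ ∋ _ ∶_) (trans (renE-renE ty wkⁿ (emb r) A) (sym (renE-renE ty (liftⁿ (emb r)) wkⁿ A)))
      (skipⁿ (emb-∋ r i))
  emb-∋ {A = A} (skipᵛ {Γ = Γ} {A = B} r) i =
    subst (Γ ▸ B ∋ _ ∶_) (trans (renE-renE ty wkᵛ (emb r) A) (sym (renTy-ι (emb (skipᵛ {A = B} r)) A)))
      (skipᵛ (emb-∋ r i))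

  -- Breaks the circle between substitution and weakening: a kit of typed objects presupposes typed
  -- renaming, whereas variables are weakened by membership alone.
  variableKit : Kit Variable
  variableKit = record
    { newest  = var here
    ; weakenᵛ = λ { (var i) → var (skipᵛ i) }
    ; embed   = λ { r (var i) → var (emb-∋ r i) }
    }

  variable-typed : ∀ {Γ : Ctx n m} {M N A} → Variable Γ M N A → Γ ⊢ M ∶ A
  variable-typed (var i) = var i

  module Renaming where
    open SubRelOps variableKit public
    open Substitution variableKit variable-typed public

  infix 3 _⊢ʳ_∶_
  _⊢ʳ_∶_ : Ctx n' m' → Ren n m n' m' → Ctx n m → Set
  Δ ⊢ʳ ρ ∶ Γ = SubRel Variable Δ (ι ρ) (ι ρ) Γ

  wkᵛ-ren : ∀ {Γ : Ctx n m} {A} → Γ ▸ A ⊢ʳ wkᵛ ∶ Γ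
  wkᵛ-ren {Γ = Γ} = Renaming.SubRel-weakenᵛ (Renaming.SubRel-id Γ)

  wkⁿ-ren : ∀ {Γ : Ctx n m} {α} → Γ # α ⊢ʳ wkⁿ ∶ Γ
  wkⁿ-ren {Γ = Γ} = Renaming.SubRel-weakenⁿ (Renaming.SubRel-id Γ)

  emb-ren : ∀ {Γ : Ctx n m} {Γ' : Ctx n' m'} {a α} (r : Γ ⊢ a ∶ α ╲ Γ') → Γ ⊢ʳ emb r ∶ Γ'
  emb-ren here      = wkⁿ-ren
  emb-ren (skipⁿ r) = Renaming.SubRel-liftⁿ (emb-ren r)
  emb-ren (skipᵛ r) = Renaming.SubRel-weakenᵛ (emb-ren r)

  -- The map `instName a` from `Γ # α` to `Γ` is no such renaming, as it identifies the new name
  -- with one of `Γ`. Starting from the restriction `Γ'`, where `a` is absent, removes the clash.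
  consʳ-ren : ∀ {Γ : Ctx n m} {Γ' : Ctx n' m'} {a α} (r : Γ ⊢ a ∶ α ╲ Γ') →
              Γ ⊢ʳ consʳ a (emb r) ∶ (Γ' # α)
  consʳ-ren {Γ' = Γ'} r = named r (Renaming.SubRel-id Γ') refl refl ≈-refl ≈-refl

  ren-kind : ∀ {Δ : Ctx n' m'} {Γ : Ctx n m} {ρ K} → Δ ⊢ʳ ρ ∶ Γ →
             Γ ⊢ K kind → Δ ⊢ renKind ρ K kind
  ren-kind {Δ = Δ} {ρ = ρ} {K} s k = subst (Δ ⊢_kind) (sym (renKind-ι ρ K)) (Renaming.sub-kind s k)

  ren-type : ∀ {Δ : Ctx n' m'} {Γ : Ctx n m} {ρ A} → Δ ⊢ʳ ρ ∶ Γ →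
             Γ ⊢ᵗ A ∶ type → Δ ⊢ᵗ renTy ρ A ∶ type
  ren-type {Δ = Δ} {ρ = ρ} {A} s t =
    subst (Δ ⊢ᵗ_∶ type) (sym (renTy-ι ρ A)) (Renaming.sub-type s t)

  ren-obj : ∀ {Δ : Ctx n' m'} {Γ : Ctx n m} {ρ M A} → Δ ⊢ʳ ρ ∶ Γ →
            Γ ⊢ M ∶ A → Δ ⊢ renObj ρ M ∶ renTy ρ A
  ren-obj {ρ = ρ} {M} {A} s t =
    coe (sym (renObj-ι ρ M)) (sym (renTy-ι ρ A)) (Renaming.sub-obj s t)

  ren-type≐ : ∀ {Δ : Ctx n' m'} {Γ : Ctx n m} {ρ A B} → Δ ⊢ʳ ρ ∶ Γ →
              Γ ⊢ᵗ A ≐ B ∶ type → Δ ⊢ᵗ renTy ρ A ≐ renTy ρ B ∶ type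
  ren-type≐ {ρ = ρ} {A} {B} s e =
    coeᵗ≐ (sym (renTy-ι ρ A)) (sym (renTy-ι ρ B)) refl (Renaming.sub-type≐ s e)

  ren-obj≐ : ∀ {Δ : Ctx n' m'} {Γ : Ctx n m} {ρ M N A} → Δ ⊢ʳ ρ ∶ Γ →
             Γ ⊢ M ≐ N ∶ A → Δ ⊢ renObj ρ M ≐ renObj ρ N ∶ renTy ρ A
  ren-obj≐ {ρ = ρ} {M} {N} {A} s e =
    coe≐ (sym (renObj-ι ρ M)) (sym (renObj-ι ρ N)) (sym (renTy-ι ρ A)) (Renaming.sub-obj≐ s e)

  conc-type : ∀ {Γ : Ctx n m} {Γ' : Ctx n' m'} {a α B} (r : Γ ⊢ a ∶ α ╲ Γ') →
              Γ' # α ⊢ᵗ B ∶ type → Γ ⊢ᵗ renTy (liftⁿ (emb r)) B [ a ]ⁿᵗ ∶ type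
  conc-type {Γ = Γ} {B = B} r t =
    subst (Γ ⊢ᵗ_∶ type) (sym (instName-liftⁿ ty _ (emb r) B)) (ren-type (consʳ-ren r) t)

  conc-obj : ∀ {Γ : Ctx n m} {Γ' : Ctx n' m'} {a α M B} (r : Γ ⊢ a ∶ α ╲ Γ') →
             Γ' # α ⊢ M ∶ B →
             Γ ⊢ renObj (liftⁿ (emb r)) M [ a ]ⁿ ∶ renTy (liftⁿ (emb r)) B [ a ]ⁿᵗ
  conc-obj {M = M} {B} r t =
    coe (sym (instName-liftⁿ obj _ (emb r) M)) (sym (instName-liftⁿ ty _ (emb r) B))
      (ren-obj (consʳ-ren r) t)

  conc-type≐ : ∀ {Γ : Ctx n m} {Γ' : Ctx n' m'} {a α A B} (r : Γ ⊢ a ∶ α ╲ Γ') →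
               Γ' # α ⊢ᵗ A ≐ B ∶ type →
               Γ ⊢ᵗ renTy (liftⁿ (emb r)) A [ a ]ⁿᵗ ≐ renTy (liftⁿ (emb r)) B [ a ]ⁿᵗ ∶ type
  conc-type≐ {A = A} {B} r e =
    coeᵗ≐ (sym (instName-liftⁿ ty _ (emb r) A)) (sym (instName-liftⁿ ty _ (emb r) B)) refl
      (ren-type≐ (consʳ-ren r) e)

  -- Typed substitution and functionality

  Typed : Pred
  Typed Γ M _ A = Γ ⊢ M ∶ A

  typedKit : Kit Typed
  typedKit = record
    { newest  = var here
    ; weakenᵛ = ren-obj wkᵛ-ren
    ; embed   = λ r → ren-obj (emb-ren r)
    }

  module TypedSub where
    open SubRelOps typedKit public
    open Substitution typedKit id public

  -- Typing of the first object is recorded since it cannot yet be read off the equality: that is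
  -- regularity, whose proof uses functionality.
  Related : Pred
  Related Γ M N A = (Γ ⊢ M ∶ A) × (Γ ⊢ M ≐ N ∶ A)

  relatedKit : Kit Related
  relatedKit = record
    { newest  = var here , var here
    ; weakenᵛ = λ (t , e) → ren-obj wkᵛ-ren t , ren-obj≐ wkᵛ-ren e
    ; embed   = λ r (t , e) → ren-obj (emb-ren r) t , ren-obj≐ (emb-ren r) e
    }

  module Functionality where
    open SubRelOps relatedKit public
    open Substitution relatedKit proj₁ public

    mutual
      fun-kind : ∀ {Δ : Ctx n' m'} {Γ : Ctx n m} {σ τ K} → SubRel Related Δ σ τ Γ →
                 Γ ⊢ K kind → Δ ⊢ᵏ subKind σ K ≐ subKind τ K
      fun-kind s type    = type
      fun-kind s (Π A K) = Π-cong (sub-type s A) (fun-type s A) (fun-kind (SubRel-liftᵛ _ s) K)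

      -- Classifiers are instantiated by `σ` throughout, so a conversion inside the derivation is
      -- substituted along `σ`, whose typing is part of `Related`.
      fun-type : ∀ {Δ : Ctx n' m'} {Γ : Ctx n m} {σ τ A K} → SubRel Related Δ σ τ Γ →
                 Γ ⊢ᵗ A ∶ K → Δ ⊢ᵗ subTy σ A ≐ subTy τ A ∶ subKind σ K
      fun-type s (con {K = K} i) = coeᵗ≐ refl refl (sym (subE-closed kind _ K)) (con i)
      fun-type s (app {M = M} {K = K} A N) =
        coeᵗ≐ refl refl (sym (subE-instVar kind _ M K)) (app-cong (fun-type s A) (fun-obj s N))
      fun-type s (Π A B)    = Π-cong (sub-type s A) (fun-type s A) (fun-type (SubRel-liftᵛ _ s) B)
      fun-type s (name i)   = name i
      fun-type s (New i B)  = New-cong i (fun-type (SubRel-liftⁿ s) B)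
      fun-type s (conv A e) = conv (fun-type s A) (≐-sym (sub-kind≐ s e))

      fun-obj : ∀ {Δ : Ctx n' m'} {Γ : Ctx n m} {σ τ M A} → SubRel Related Δ σ τ Γ →
                Γ ⊢ M ∶ A → Δ ⊢ subObj σ M ≐ subObj τ M ∶ subTy σ A
      fun-obj s (con {A = A} i) = coe≐ refl refl (sym (subE-closed ty _ A)) (con i)
      fun-obj s (var i)    = proj₂ (SubRel-lookup s i)
      fun-obj {τ = τ} s (name {a = a} i)
        with _ , _ , _ , r ← ∋ⁿ⇒restriction i
        with restricted _ _ e f _ _ ← SubRel-restrict s r =
        coe≐ refl (cong name (trans e (sym f))) refl (name (SubRel-name s i))
      fun-obj s (lam A M)  =
        ƛ-cong (sub-type s A) (type-refl (sub-type s A)) (≐-sym (fun-type s A))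
          (fun-obj (SubRel-liftᵛ _ s) M)
      fun-obj s (app {N = N} {B = B} L O) =
        coe≐ refl refl (sym (subE-instVar ty _ N B)) (app-cong (fun-obj s L) (fun-obj s O))
      fun-obj s (abs i M)  = ⟨⟩-cong i (fun-obj (SubRel-liftⁿ s) M)
      fun-obj s (conc {a = a} {M = M} {B = B} r N)
        with restricted r' s' e f p q ← SubRel-restrict s r =
        coe≐ (cong₂ _＠_ (sym (subE-renE-comm obj p M)) (sym e))
          (cong₂ _＠_ (sym (subE-renE-comm obj q M)) (sym f))
          (trans (cong (renTy _ _ [_]ⁿᵗ) (sym e)) (sym (subE-instName ty p a B)))
          (＠-cong r' (fun-obj s' N))
      fun-obj s (conv M e) = conv (fun-obj s M) (sub-type≐ s e)

  typed-inst : ∀ {Γ : Ctx n m} {M A} → Γ ⊢ M ∶ A → SubRel Typed Γ (instVar M) (instVar M) (Γ ▸ A)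
  typed-inst {M = M} t = TypedSub.SubRel-inst {N = M} t

  related-inst : ∀ {Γ : Ctx n m} {M N A} → Γ ⊢ M ∶ A → Γ ⊢ M ≐ N ∶ A →
                 SubRel Related Γ (instVar M) (instVar N) (Γ ▸ A)
  related-inst t e = Functionality.SubRel-inst (t , e)

  -- The identity substitution does it, with the last variable retyped by the converse equation.
  ctx-conv : ∀ {Γ : Ctx n m} {A B} → Γ ⊢ᵗ A ≐ B ∶ type → SubRel Typed (Γ ▸ B) idˢ idˢ (Γ ▸ A)
  ctx-conv {Γ = Γ} {A} e =
    TypedSub.SubRel-weakenᵛ (TypedSub.SubRel-id Γ) ▸
    coe refl (renTy-ι wkᵛ A) (conv (var here) (ren-type≐ wkᵛ-ren (≐-sym e)))

  ctx-conv-kind : ∀ {Γ : Ctx n m} {A B K} → Γ ⊢ᵗ A ≐ B ∶ type →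
                  Γ ▸ A ⊢ K kind → Γ ▸ B ⊢ K kind
  ctx-conv-kind {K = K} e t = subst (_ ⊢_kind) (subKind-id K) (TypedSub.sub-kind (ctx-conv e) t)

  ctx-conv-type : ∀ {Γ : Ctx n m} {A B C} → Γ ⊢ᵗ A ≐ B ∶ type →
                  Γ ▸ A ⊢ᵗ C ∶ type → Γ ▸ B ⊢ᵗ C ∶ type
  ctx-conv-type {C = C} e t = subst (_ ⊢ᵗ_∶ type) (subTy-id C) (TypedSub.sub-type (ctx-conv e) t)

  ctx-conv-obj : ∀ {Γ : Ctx n m} {A B M C} → Γ ⊢ᵗ A ≐ B ∶ type →
                 Γ ▸ A ⊢ M ∶ C → Γ ▸ B ⊢ M ∶ C
  ctx-conv-obj {M = M} {C} e t = coe (subObj-id M) (subTy-id C) (TypedSub.sub-obj (ctx-conv e) t)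

  ctx-conv-kind≐ : ∀ {Γ : Ctx n m} {A B K L} → Γ ⊢ᵗ A ≐ B ∶ type →
                   Γ ▸ A ⊢ᵏ K ≐ L → Γ ▸ B ⊢ᵏ K ≐ L
  ctx-conv-kind≐ {K = K} {L} e t =
    subst₂ (_ ⊢ᵏ_≐_) (subKind-id K) (subKind-id L) (TypedSub.sub-kind≐ (ctx-conv e) t)

  ctx-conv-type≐ : ∀ {Γ : Ctx n m} {A B C D} → Γ ⊢ᵗ A ≐ B ∶ type →
                   Γ ▸ A ⊢ᵗ C ≐ D ∶ type → Γ ▸ B ⊢ᵗ C ≐ D ∶ type
  ctx-conv-type≐ {C = C} {D} e t =
    coeᵗ≐ (subTy-id C) (subTy-id D) refl (TypedSub.sub-type≐ (ctx-conv e) t)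

  -- Inversion

  data KindMatch {n m} (Γ : Ctx n m) : Kind n m → Kind n m → Set where
    type : KindMatch Γ type type
    Π    : ∀ {A B K L} → Γ ⊢ᵗ A ≐ B ∶ type → Γ ▸ A ⊢ᵏ K ≐ L → KindMatch Γ (Π A K) (Π B L)

  -- Besides symmetry and transitivity, kind equality has only congruences. Codomains are compared
  -- over the left domain, so both of these rules need a change of context.
  kind-match : ∀ {Γ : Ctx n m} {K L} → Γ ⊢ᵏ K ≐ L → KindMatch Γ K L
  kind-match (≐-sym e) with kind-match e
  ... | type  = type
  ... | Π f g = Π (≐-sym f) (≐-sym (ctx-conv-kind≐ f g))
  kind-match (≐-trans e e') with kind-match e | kind-match e'
  ... | type  | type    = type
  ... | Π f g | Π f' g' = Π (≐-trans f f') (≐-trans g (ctx-conv-kind≐ (≐-sym f) g'))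
  kind-match type           = type
  kind-match (Π-cong _ e f) = Π e f

  data Neutral {n m} : Ty n m → Set where
    con  : ∀ {a} → Neutral (con a)
    app  : ∀ {A M} → Neutral (A · M)
    name : ∀ {α} → Neutral (name α)

  data TypeMatch {n m} (Γ : Ctx n m) : Ty n m → Ty n m → Set where
    Π       : ∀ {A₁ A₂ B₁ B₂} → Γ ⊢ᵗ A₁ ≐ B₁ ∶ type → Γ ▸ A₁ ⊢ᵗ A₂ ≐ B₂ ∶ type →
              TypeMatch Γ (Π A₁ A₂) (Π B₁ B₂)
    New     : ∀ {α A B} → Γ # α ⊢ᵗ A ≐ B ∶ type → TypeMatch Γ (New α A) (New α B)
    neutral : ∀ {A B} → Neutral A → Neutral B → TypeMatch Γ A B

  -- Type extensionality does not interfere: it only equates families of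
  -- product kind, and neither Π nor New is one.
  type-match : ∀ {Γ : Ctx n m} {A B K} → Γ ⊢ᵗ A ≐ B ∶ K → K ≡ type → TypeMatch Γ A B
  type-match (≐-sym e) h with type-match e h
  ... | Π f g       = Π (≐-sym f) (≐-sym (ctx-conv-type≐ f g))
  ... | New f       = New (≐-sym f)
  ... | neutral p q = neutral q p
  type-match (≐-trans e e') h with type-match e h | type-match e' h
  ... | Π f g       | Π f' g'       = Π (≐-trans f f') (≐-trans g (ctx-conv-type≐ (≐-sym f) g'))
  ... | New f       | New f'        = New (≐-trans f f')
  ... | neutral p _ | neutral _ q   = neutral p q
  type-match (conv e f) refl with type ← kind-match f = type-match e refl
  type-match (con _)        _  = neutral con con
  type-match (app-cong _ _) _  = neutral app app
  type-match (Π-cong _ e f) _  = Π e f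
  type-match (name _)       _  = neutral name name
  type-match (New-cong _ e) _  = New e

  Π-inv : ∀ {Γ : Ctx n m} {A B K} → Γ ⊢ᵗ Π A B ∶ K →
          (Γ ⊢ᵗ A ∶ type) × (Γ ▸ A ⊢ᵗ B ∶ type) × (K ≡ type)
  Π-inv (Π A B)    = A , B , refl
  Π-inv (conv t e) with A , B , refl ← Π-inv t with type ← kind-match e = A , B , refl

  New-inv : ∀ {Γ : Ctx n m} {α B K} → Γ ⊢ᵗ New α B ∶ K →
            ((α ∶name) ∈ Σ) × (Γ # α ⊢ᵗ B ∶ type) × (K ≡ type)
  New-inv (New i B)  = i , B , refl
  New-inv (conv t e) with i , B , refl ← New-inv t with type ← kind-match e = i , B , refl

  -- Reflexivity of type equality at A presupposes that A is a type, which
  -- inversion does not provide before regularity is known.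
  infix 3 _⊢_≲_
  _⊢_≲_ : Ctx n m → Ty n m → Ty n m → Set
  Γ ⊢ A ≲ B = A ≡ B ⊎ (Γ ⊢ᵗ A ≐ B ∶ type)

  ≲-conv : ∀ {Γ : Ctx n m} {A B C} → Γ ⊢ A ≲ B → Γ ⊢ᵗ B ≐ C ∶ type → Γ ⊢ A ≲ C
  ≲-conv (inj₁ refl) f = inj₂ f
  ≲-conv (inj₂ e)    f = inj₂ (≐-trans e f)

  -- Rule `conc` types a preimage of `M`; the equation leaves it to each use to identify that
  -- preimage.
  data ConcInv {n m} (Γ : Ctx n m) (M : Obj n m) (a : Fin m) (A : Ty n m) : Set where
    concInv : ∀ {n' m'} {Γ' : Ctx n' m'} {α N B} (r : Γ ⊢ a ∶ α ╲ Γ') →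
              M ≡ renObj (emb r) N → Γ' ⊢ N ∶ New α B →
              Γ ⊢ renTy (liftⁿ (emb r)) B [ a ]ⁿᵗ ≲ A → ConcInv Γ M a A

  conc-inv : ∀ {Γ : Ctx n m} {P M a A} → Γ ⊢ P ∶ A → P ≡ M ＠ a → ConcInv Γ M a A
  conc-inv (conc r N) refl = concInv r refl N (inj₁ refl)
  conc-inv (conv t e) refl with concInv r p N f ← conc-inv t refl = concInv r p N (≲-conv f e)

  -- Rule `newExt` leaves its objects untyped just as `tyExt` does its families, yet here no
  -- strengthening is missing: the only restriction by the name `zero` is `here`, so `conc` types
  -- the preimage over `Γ` itself.
  eta-New-inv : ∀ {Γ : Ctx n m} {α M A} → (α ∶name) ∈ Σ →
                Γ # α ⊢ renObj wkⁿ M ＠ zero ∶ A → Γ ⊢ M ∶ New α A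
  eta-New-inv {Γ = Γ} {α} i t with conc-inv t refl
  ... | concInv {B = B} here e N f with refl ← renObj-injective (emb-injective {Γ = Γ # α} here) e
    with subst (_ ⊢_≲ _) (instName-liftⁿ-wkⁿ ty B) f
  ... | inj₁ refl = N
  ... | inj₂ g    = conv N (New-cong i g)

  -- Regularity

  -- A substitute for Γ ⊢ᵗ A ∶ K; it suffices because a family of product kind
  -- is only ever used applied.
  data Fam {n m} (Γ : Ctx n m) : Kind n m → Ty n m → Set where
    type : ∀ {A} → Γ ⊢ᵗ A ∶ type → Fam Γ type A
    Π    : ∀ {A C K} → (∀ M → Γ ⊢ M ∶ C → Fam Γ (K [ M ]ᵏ) (A · M)) → Fam Γ (Π C K) A

  -- A pending substitution is carried because `K [ M ]ᵏ` is not a part of `Π C K`; the recursion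
  -- can then follow `K`.
  typed⇒Fam-sub : ∀ {Γ : Ctx n m} {A} (K : Kind n' m') σ → Γ ⊢ᵗ A ∶ subKind σ K →
              Fam Γ (subKind σ K) A
  typed⇒Fam-sub type    σ t = type t
  typed⇒Fam-sub {Γ = Γ} {A} (Π C K) σ t = Π λ M M∶ →
    let eq = sym (instVar-liftˢᵛ kind M σ K)
    in subst (λ L → Fam Γ L (A · M)) eq
         (typed⇒Fam-sub K (consˢ M σ) (coeᵗ (sym eq) (app t M∶)))

  typed⇒Fam : ∀ {Γ : Ctx n m} {A K} → Γ ⊢ᵗ A ∶ K → Fam Γ K A
  typed⇒Fam {Γ = Γ} {A} {K} t = subst (λ L → Fam Γ L A) (subKind-id K)
    (typed⇒Fam-sub K idˢ (coeᵗ (sym (subKind-id K)) t))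

  -- Recursion on the `Fam` derivation, since the instantiated kind equation is not a part of the
  -- given one.
  Fam-conv : ∀ {Γ : Ctx n m} {A K L} → Fam Γ K A → Γ ⊢ᵏ K ≐ L → Fam Γ L A
  Fam-conv (type t) e with type ← kind-match e = type t
  Fam-conv (Π f)    e with Π c g ← kind-match e =
    Π λ M M∶ → Fam-conv (f M (conv M∶ (≐-sym c)))
                 (TypedSub.sub-kind≐ (typed-inst (conv M∶ (≐-sym c))) g)

  Fam-type : ∀ {Γ : Ctx n m} {A} → Fam Γ type A → Γ ⊢ᵗ A ∶ type
  Fam-type (type t) = t

  module Regularity (⊢Σ : ⊢ Σ sig) where

    ctx-lookup : ∀ {Γ : Ctx n m} {x A} → ⊢ Γ ctx → Γ ∋ x ∶ A → Γ ⊢ᵗ A ∶ type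
    ctx-lookup (Γ ▸ A) here      = ren-type wkᵛ-ren A
    ctx-lookup (Γ ▸ _) (skipᵛ i) = ren-type wkᵛ-ren (ctx-lookup Γ i)
    ctx-lookup (Γ # _) (skipⁿ i) = ren-type wkⁿ-ren (ctx-lookup Γ i)

    ctx-name : ∀ {Γ : Ctx n m} {a α} → ⊢ Γ ctx → Γ ∋ⁿ a ∶ α → (α ∶name) ∈ Σ
    ctx-name (Γ # i) here      = i
    ctx-name (Γ # _) (skipⁿ i) = ctx-name Γ i
    ctx-name (Γ ▸ _) (skipᵛ i) = ctx-name Γ i

    ctx-restrict : ∀ {Γ : Ctx n m} {Γ' : Ctx n' m'} {a α} → ⊢ Γ ctx →
                   Γ ⊢ a ∶ α ╲ Γ' → ⊢ Γ' ctx
    ctx-restrict (Γ # _) here      = Γ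
    ctx-restrict (Γ # i) (skipⁿ r) = ctx-restrict Γ r # i
    ctx-restrict (Γ ▸ _) (skipᵛ r) = ctx-restrict Γ r

    lam-conv : ∀ {Γ : Ctx n m} {A A' M B} → Γ ⊢ᵗ A' ∶ type → Γ ⊢ᵗ A' ≐ A ∶ type →
               Γ ▸ A ⊢ M ∶ B → Γ ▸ A ⊢ᵗ B ∶ type → Γ ⊢ ƛ A' M ∶ Π A B
    lam-conv A' e M B = conv (lam A' (ctx-conv-obj (≐-sym e) M))
      (Π-cong A' e (ctx-conv-type≐ (≐-sym e) (type-refl B)))

    mutual
      obj-valid : ∀ {Γ : Ctx n m} {M A} → ⊢ Γ ctx → Γ ⊢ M ∶ A → Γ ⊢ᵗ A ∶ type
      obj-valid Γ (con i)    = ren-type ∙ (∈⇒type ⊢Σ i)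
      obj-valid Γ (var i)    = ctx-lookup Γ i
      obj-valid Γ (name i)   = name (ctx-name Γ i)
      obj-valid Γ (lam A M)  = Π A (obj-valid (Γ ▸ A) M)
      obj-valid Γ (app M N) with _ , B , _ ← Π-inv (obj-valid Γ M) =
        TypedSub.sub-type (typed-inst N) B
      obj-valid Γ (abs i M)  = New i (obj-valid (Γ # i) M)
      obj-valid Γ (conc r M) with _ , B , _ ← New-inv (obj-valid (ctx-restrict Γ r) M) =
        conc-type r B
      obj-valid Γ (conv M e) = proj₂ (type≐-valid Γ e)

      type-valid : ∀ {Γ : Ctx n m} {A K} → ⊢ Γ ctx → Γ ⊢ᵗ A ∶ K → Γ ⊢ K kind
      type-valid Γ (con i)    = ren-kind ∙ (∈⇒kind ⊢Σ i)
      type-valid Γ (app A M) with Π _ K ← type-valid Γ A = TypedSub.sub-kind (typed-inst M) K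
      type-valid Γ (Π A B)    = type
      type-valid Γ (name i)   = type
      type-valid Γ (New i B)  = type
      type-valid Γ (conv A e) = proj₁ (kind≐-valid Γ e)

      kind≐-valid : ∀ {Γ : Ctx n m} {K L} → ⊢ Γ ctx → Γ ⊢ᵏ K ≐ L → (Γ ⊢ K kind) × (Γ ⊢ L kind)
      kind≐-valid Γ (≐-sym e)     = let K , L = kind≐-valid Γ e in L , K
      kind≐-valid Γ (≐-trans e f) = proj₁ (kind≐-valid Γ e) , proj₂ (kind≐-valid Γ f)
      kind≐-valid Γ type          = type , type
      kind≐-valid Γ (Π-cong A e f) =
        let K , L = kind≐-valid (Γ ▸ A) f
        in Π A K , Π (proj₂ (type≐-valid Γ e)) (ctx-conv-kind e L)

      -- Complements `type≐-Fam`, which says nothing about `K`: for `app-cong`, functionality of the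
      -- codomain kind needs that kind to be well-formed.
      type≐-kind : ∀ {Γ : Ctx n m} {A B K} → ⊢ Γ ctx → Γ ⊢ᵗ A ≐ B ∶ K → Γ ⊢ K kind
      type≐-kind Γ (≐-sym e)      = type≐-kind Γ e
      type≐-kind Γ (≐-trans e _)  = type≐-kind Γ e
      type≐-kind Γ (conv e f)     = proj₂ (kind≐-valid Γ f)
      type≐-kind Γ (con i)        = ren-kind ∙ (∈⇒kind ⊢Σ i)
      type≐-kind Γ (app-cong e f) with Π _ K ← type≐-kind Γ e | M , _ ← obj≐-valid Γ f =
        TypedSub.sub-kind (typed-inst M) K
      type≐-kind Γ (Π-cong _ _ _) = type
      type≐-kind Γ (tyExt B e)    = Π B (type≐-kind (Γ ▸ B) e)
      type≐-kind Γ (name _)       = type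
      type≐-kind Γ (New-cong _ _) = type

      -- The substitution is carried along rather than applied to the derivation, since a
      -- substituted derivation is no longer a part of the given one and could not be recursed on.
      type≐-Fam : ∀ {Δ : Ctx n' m'} {Γ : Ctx n m} {σ τ A B K} → ⊢ Γ ctx → Γ ⊢ᵗ A ≐ B ∶ K →
                  SubRel Typed Δ σ τ Γ →
                  Fam Δ (subKind σ K) (subTy σ A) × Fam Δ (subKind σ K) (subTy σ B)
      type≐-Fam Γ (≐-sym e)     s = let A , B = type≐-Fam Γ e s in B , A
      type≐-Fam Γ (≐-trans e f) s = proj₁ (type≐-Fam Γ e s) , proj₂ (type≐-Fam Γ f s)
      type≐-Fam Γ (conv e f)    s =
        let A , B = type≐-Fam Γ e s
            f'    = TypedSub.sub-kind≐ s f
        in Fam-conv A f' , Fam-conv B f'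
      type≐-Fam Γ (con i) s = let F = typed⇒Fam (TypedSub.sub-type s (con i)) in F , F
      type≐-Fam Γ (app-cong {M = M} {N} {K = K} e f) s
        with Π A , Π B ← type≐-Fam Γ e s
           | Π _ K∶ ← type≐-kind Γ e
           | M∶ , N∶ , _ ← obj≐-valid Γ f =
        subst (λ L → Fam _ L _) (sym (subE-instVar kind _ M K))
          (A _ (TypedSub.sub-obj s M∶)) ,
        -- The right-hand family is applied to `N` and lands in the instance of `K` at `N`;
        -- functionality of `K` leads back to the instance at `M`.
        Fam-conv
          (subst (λ L → Fam _ L _) (sym (subE-instVar kind _ N K)) (B _ (TypedSub.sub-obj s N∶)))
          (≐-sym (TypedSub.sub-kind≐ s (Functionality.fun-kind (related-inst M∶ f) K∶)))
      type≐-Fam Γ (Π-cong A e f) s =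
        let A∶ , A' = type≐-valid Γ e
            B∶ , B' = type≐-valid (Γ ▸ A) f
        in type (TypedSub.sub-type s (Π A∶ B∶)) ,
           type (TypedSub.sub-type s (Π A' (ctx-conv-type e B')))
      type≐-Fam {Δ = Δ} {σ = σ} {τ} Γ (tyExt {A₁} {A₂} {K = K} B e) s =
        Π (λ M M∶ → apply A₁ M (proj₁ (type≐-Fam (Γ ▸ B) e (extend M M∶)))) ,
        Π (λ M M∶ → apply A₂ M (proj₂ (type≐-Fam (Γ ▸ B) e (extend M M∶))))
        where
        extend : ∀ M → Δ ⊢ M ∶ _ → SubRel Typed Δ (consˢ M σ) (consˢ M τ) _
        extend M M∶ = s ▸ M∶
        -- `consˢ M σ` cancels the weakening of the family and sends `var zero` to `M`, so the
        -- premise of `tyExt` speaks of `subTy σ A · M`.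
        apply : ∀ A M → Fam Δ (subKind (consˢ M σ) K) (subTy (consˢ M σ) (renTy wkᵛ A) · M) →
                Fam Δ (subKind (liftˢᵛ σ) K [ M ]ᵏ) (subTy σ A · M)
        apply A M = subst₂ (λ L C → Fam Δ L (C · M)) (sym (instVar-liftˢᵛ kind M σ K))
          (subTy-renTy (consˢ M σ) wkᵛ A)
      type≐-Fam Γ (name i) s = type (name i) , type (name i)
      type≐-Fam Γ (New-cong i e) s =
        let A , B = type≐-valid (Γ # i) e
        in type (TypedSub.sub-type s (New i A)) , type (TypedSub.sub-type s (New i B))

      type≐-valid : ∀ {Γ : Ctx n m} {A B} → ⊢ Γ ctx → Γ ⊢ᵗ A ≐ B ∶ type →
                    (Γ ⊢ᵗ A ∶ type) × (Γ ⊢ᵗ B ∶ type)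
      type≐-valid {A = A} {B} Γ e =
        let F , G = type≐-Fam Γ e (TypedSub.SubRel-id _)
        in subst (_ ⊢ᵗ_∶ type) (subTy-id A) (Fam-type F) ,
           subst (_ ⊢ᵗ_∶ type) (subTy-id B) (Fam-type G)

      obj≐-valid : ∀ {Γ : Ctx n m} {M N A} → ⊢ Γ ctx → Γ ⊢ M ≐ N ∶ A →
                   (Γ ⊢ M ∶ A) × (Γ ⊢ N ∶ A) × (Γ ⊢ᵗ A ∶ type)
      obj≐-valid Γ (≐-sym e) = let M , N , A = obj≐-valid Γ e in N , M , A
      obj≐-valid Γ (≐-trans e f) =
        let M , _ , A = obj≐-valid Γ e
            _ , P , _ = obj≐-valid Γ f
        in M , P , A
      obj≐-valid Γ (conv e f) =
        let M , N , _ = obj≐-valid Γ e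
        in conv M f , conv N f , proj₂ (type≐-valid Γ f)
      obj≐-valid Γ (var i) = var i , var i , ctx-lookup Γ i
      obj≐-valid Γ (con i) = con i , con i , ren-type ∙ (∈⇒type ⊢Σ i)
      obj≐-valid Γ (app-cong e f) =
        let M₁ , N₁ , C  = obj≐-valid Γ e
            M₂ , N₂ , _  = obj≐-valid Γ f
            _ , B , _    = Π-inv C
        in app M₁ M₂ ,
           conv (app N₁ N₂) (≐-sym (Functionality.fun-type (related-inst M₂ f) B)) ,
           TypedSub.sub-type (typed-inst M₂) B
      obj≐-valid Γ (ƛ-cong A e e' f) =
        let M , N , B = obj≐-valid (Γ ▸ A) f
        in lam-conv (proj₁ (type≐-valid Γ e)) e M B ,
           lam-conv (proj₁ (type≐-valid Γ e')) e' N B , Π A B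
      obj≐-valid Γ (β A e f) =
        let M₂ , N₂ , B = obj≐-valid (Γ ▸ A) e
            M₁ , N₁ , _ = obj≐-valid Γ f
        in app (lam A M₂) M₁ ,
           conv (TypedSub.sub-obj (typed-inst N₁) N₂)
             (≐-sym (Functionality.fun-type (related-inst M₁ f) B)) ,
           TypedSub.sub-type (typed-inst M₁) B
      obj≐-valid Γ (ext A M N e) = M , N , Π A (proj₂ (proj₂ (obj≐-valid (Γ ▸ A) e)))
      obj≐-valid Γ (name i) = name i , name i , name (ctx-name Γ i)
      obj≐-valid Γ (⟨⟩-cong i e) =
        let M , N , A = obj≐-valid (Γ # i) e in abs i M , abs i N , New i A
      obj≐-valid Γ (＠-cong r e) =
        let M , N , C = obj≐-valid (ctx-restrict Γ r) e
            _ , A , _ = New-inv C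
        in conc r M , conc r N , conc-type r A
      obj≐-valid Γ (＠-β r e) =
        let i         = ctx-name Γ (restriction⇒∋ⁿ r)
            M , N , A = obj≐-valid (ctx-restrict Γ r # i) e
        in conc r (abs i M) , conc-obj r N , conc-type r A
      obj≐-valid Γ (newExt i e) =
        let M , N , A = obj≐-valid (Γ # i) e
        in eta-New-inv i M , eta-New-inv i N , New i A

    -- Soundness

    ≲⇒≐ : ∀ {Γ : Ctx n m} {A B} → Γ ⊢ᵗ A ∶ type → Γ ⊢ A ≲ B → Γ ⊢ᵗ A ≐ B ∶ type
    ≲⇒≐ A (inj₁ refl) = type-refl A
    ≲⇒≐ A (inj₂ e)    = e

    conv-≲ : ∀ {Γ : Ctx n m} {M N A B} → Γ ⊢ M ≐ N ∶ A → Γ ⊢ A ≲ B → Γ ⊢ M ≐ N ∶ B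
    conv-≲ e (inj₁ refl) = e
    conv-≲ e (inj₂ f)    = conv e f

    -- Generation lemmas for objects

    con-inv : ∀ {Γ : Ctx n m} {c B} → Γ ⊢ con c ∶ B →
              ∃[ A ] ((c ∶ᵒ A) ∈ Σ) × (Γ ⊢ renTy fromClosed A ≲ B)
    con-inv (con i)    = _ , i , inj₁ refl
    con-inv (conv t e) = let _ , i , f = con-inv t in _ , i , ≲-conv f e

    var-inv : ∀ {Γ : Ctx n m} {x B} → Γ ⊢ var x ∶ B → ∃[ A ] (Γ ∋ x ∶ A) × (Γ ⊢ A ≲ B)
    var-inv (var i)    = _ , i , inj₁ refl
    var-inv (conv t e) = let _ , i , f = var-inv t in _ , i , ≲-conv f e

    name-inv : ∀ {Γ : Ctx n m} {a B} → Γ ⊢ name a ∶ B →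
               ∃[ α ] (Γ ∋ⁿ a ∶ α) × (Γ ⊢ name α ≲ B)
    name-inv (name i)   = _ , i , inj₁ refl
    name-inv (conv t e) = let _ , i , f = name-inv t in _ , i , ≲-conv f e

    lam-inv : ∀ {Γ : Ctx n m} {A M C} → Γ ⊢ ƛ A M ∶ C →
              ∃[ B ] (Γ ⊢ᵗ A ∶ type) × (Γ ▸ A ⊢ M ∶ B) × (Γ ⊢ Π A B ≲ C)
    lam-inv (lam A M)  = _ , A , M , inj₁ refl
    lam-inv (conv t e) = let _ , A , M , f = lam-inv t in _ , A , M , ≲-conv f e

    app-inv : ∀ {Γ : Ctx n m} {M N C} → Γ ⊢ M · N ∶ C →
              ∃[ A ] ∃[ B ] (Γ ⊢ M ∶ Π A B) × (Γ ⊢ N ∶ A) × (Γ ⊢ B [ N ]ᵗ ≲ C)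
    app-inv (app M N)  = _ , _ , M , N , inj₁ refl
    app-inv (conv t e) = let _ , _ , M , N , f = app-inv t in _ , _ , M , N , ≲-conv f e

    abs-inv : ∀ {Γ : Ctx n m} {α M C} → Γ ⊢ ⟨ α ⟩ M ∶ C →
              ∃[ B ] ((α ∶name) ∈ Σ) × (Γ # α ⊢ M ∶ B) × (Γ ⊢ New α B ≲ C)
    abs-inv (abs i M)  = _ , i , M , inj₁ refl
    abs-inv (conv t e) = let _ , i , M , f = abs-inv t in _ , i , M , ≲-conv f e

    -- Inverting the typing of M ＠ a replaces M by its preimage under emb r,
    -- so the induction has to consider the reductions of renamed objects.
    wh-sound-ren : ∀ {Γ : Ctx n m} (ρ : Ren n m n' m') {P P' M A} → ⊢ Γ ctx → P →wh P' →
                   P ≡ renObj ρ M → Γ ⊢ M ∶ A →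
                   ∃[ M' ] P' ≡ renObj ρ M' × (Γ ⊢ M ≐ M' ∶ A)
    wh-sound-ren ρ {M = ƛ _ M₂ · M₁} Γ β refl t
      with _ , _ , L , N , g ← app-inv t
      with _ , A , M , f ← lam-inv L
      with type-match (≲⇒≐ (Π A (obj-valid (Γ ▸ A) M)) f) refl
    ... | Π e e' =
      -- The argument is typed at the domain of the function's type, while rule `β` wants it at the
      -- annotation; injectivity of `Π` relates the two.
      let N' = conv N (≐-sym e)
      in M₂ [ M₁ ] , sym (renE-instVar obj ρ M₁ M₂) ,
         conv-≲ (conv (β A (obj-refl M) (obj-refl N')) (TypedSub.sub-type≐ (typed-inst N') e')) g
    wh-sound-ren ρ {M = (⟨ _ ⟩ M₀) ＠ b} Γ ＠-β refl t
      -- Only an abstraction is renamed to an abstraction. Exposing this form lets `renObj` compute,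
      -- so that the equation can be matched.
      with concInv {N = ⟨ _ ⟩ _} r refl N g ← conc-inv t refl
      with _ , i , M , f ← abs-inv N
      with type-match (≲⇒≐ (New i (obj-valid (ctx-restrict Γ r # i) M)) f) refl
    ... | New e =
      M₀ [ b ]ⁿ , sym (renE-instName obj ρ b M₀) ,
      conv-≲ (conv (＠-β r (obj-refl M)) (conc-type≐ r e)) g
    wh-sound-ren ρ {M = M · N} Γ (appˡ red) refl t =
      let _ , _ , M∶ , N∶ , g = app-inv t
          M' , p , e = wh-sound-ren ρ Γ red refl M∶
      in M' · N , cong (_· _) p , conv-≲ (app-cong e (obj-refl N∶)) g
    wh-sound-ren ρ {M = M ＠ a} Γ (＠ˡ red) refl t
      with concInv {N = N} r refl N∶ g ← conc-inv t refl =
      -- The reduction starts from the image under `ρ` of an image under `emb r`, hence the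
      -- composite renaming.
      let N' , p , e = wh-sound-ren (ρ ʳ∘ʳ emb r) (ctx-restrict Γ r) red
                         (renObj-ʳ∘ʳ ρ (emb r) N) N∶
      in renObj (emb r) N' ＠ a , cong (_＠ _) (trans p (sym (renObj-ʳ∘ʳ ρ (emb r) N'))) ,
         conv-≲ (＠-cong r e) g

    wh-sound : ∀ {Γ : Ctx n m} {M M' A} → ⊢ Γ ctx → M →wh M' → Γ ⊢ M ∶ A → Γ ⊢ M ≐ M' ∶ A
    wh-sound {M = M} Γ red t =
      let M' , p , e = wh-sound-ren (ren id id) Γ red (sym (renObj-id M)) t
      in coe≐ refl (trans (sym (renObj-id M')) (sym p)) refl e

    wh-valid : ∀ {Γ : Ctx n m} {M M' A} → ⊢ Γ ctx → M →wh M' → Γ ⊢ M ∶ A → Γ ⊢ M' ∶ A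
    wh-valid Γ red t = proj₁ (proj₂ (obj≐-valid Γ (wh-sound Γ red t)))

    -- An application erases like its head. A head erasing to an arrow would itself be a `Π`, which
    -- has kind `type` and cannot be applied. The same argument serves `New`.
    ⇒-shape : ∀ {Γ : Ctx n m} {A K τ₁ τ₂} → Γ ⊢ᵗ A ∶ K → A ⁻ ≡ τ₁ ⇒ τ₂ →
              ∃[ A₁ ] ∃[ A₂ ] A ≡ Π A₁ A₂
    ⇒-shape (Π _ _)    _ = _ , _ , refl
    ⇒-shape (conv t _) e = ⇒-shape t e
    ⇒-shape (app t _)  e with _ , _ , refl ← ⇒-shape t e with () ← proj₂ (proj₂ (Π-inv t))

    ⟨⟩ˢ-shape : ∀ {Γ : Ctx n m} {A K α τ} → Γ ⊢ᵗ A ∶ K → A ⁻ ≡ ⟨ α ⟩ˢ τ →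
                ∃[ B ] A ≡ New α B
    ⟨⟩ˢ-shape (New _ _)  refl = _ , refl
    ⟨⟩ˢ-shape (conv t _) e    = ⟨⟩ˢ-shape t e
    ⟨⟩ˢ-shape (app t _)  e    with _ , refl ← ⟨⟩ˢ-shape t e with () ← proj₂ (proj₂ (New-inv t))

    ≐⇒⁻≡ : ∀ {Γ : Ctx n m} {A B K} → Γ ⊢ᵗ A ≐ B ∶ K → A ⁻ ≡ B ⁻
    ≐⇒⁻≡ (≐-sym e)      = sym (≐⇒⁻≡ e)
    ≐⇒⁻≡ (≐-trans e f)  = trans (≐⇒⁻≡ e) (≐⇒⁻≡ f)
    ≐⇒⁻≡ (conv e _)     = ≐⇒⁻≡ e
    ≐⇒⁻≡ (con _)        = refl
    ≐⇒⁻≡ (app-cong e _) = ≐⇒⁻≡ e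
    ≐⇒⁻≡ (Π-cong _ e f) = cong₂ _⇒_ (≐⇒⁻≡ e) (≐⇒⁻≡ f)
    ≐⇒⁻≡ (tyExt {A₁} {A₂} _ e) = trans (sym (renTy⁻ wkᵛ A₁)) (trans (≐⇒⁻≡ e) (renTy⁻ wkᵛ A₂))
    ≐⇒⁻≡ (name _)       = refl
    ≐⇒⁻≡ (New-cong _ e) = cong (⟨ _ ⟩ˢ_) (≐⇒⁻≡ e)

    eta-app : ∀ {Γ : Ctx n m} {M A B} → Γ ⊢ M ∶ Π A B → Γ ▸ A ⊢ renObj wkᵛ M · var zero ∶ B
    eta-app {B = B} t = coe refl (instVar-liftᵛ-wkᵛ ty B) (app (ren-obj wkᵛ-ren t) (var here))

    eta-conc : ∀ {Γ : Ctx n m} {M α B} → Γ ⊢ M ∶ New α B → Γ # α ⊢ renObj wkⁿ M ＠ zero ∶ B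
    eta-conc {B = B} t = coe refl (instName-liftⁿ-wkⁿ ty B) (conc here t)

    -- Induction on algorithmic derivations

    open Algorithm Σ

    StructurallySound : Ctx n m → Obj n m → Obj n m → Ty n m → Ty n m → STy → Set
    StructurallySound Γ M N A B τ =
      (Γ ⊢ᵗ A ≐ B ∶ type) × (Γ ⊢ M ≐ N ∶ A) × (A ⁻ ≡ τ) × (τ ≡ B ⁻)

    -- The common end of all structural cases: `A` and `B` are the types that the rules themselves
    -- give to the two sides, and inversion relates them to the assigned types `A'` and `B'`.
    sound-≐ : ∀ {Γ : Ctx n m} {M N A B A' B' τ} → ⊢ Γ ctx → Γ ⊢ M ≐ N ∶ A → Γ ⊢ᵗ A ≐ B ∶ type →
              A ⁻ ≡ τ → Γ ⊢ A ≲ A' → Γ ⊢ B ≲ B' → StructurallySound Γ M N A' B' τ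
    sound-≐ Γ e f refl g h =
      let A , B = type≐-valid Γ f
          g'    = ≲⇒≐ A g
          f'    = ≐-trans f (≲⇒≐ B h)
      in ≐-trans (≐-sym g') f' , conv e g' , sym (≐⇒⁻≡ g') , ≐⇒⁻≡ f'

    mutual
      -- The algorithm branches on the form of the simple type, and `A ⁻` does not reduce for
      -- unknown `A`; hence `τ` with an equation.
      sound-⇔ : ∀ {Γ : Ctx n m} {M N A τ} → ⊢ Γ ctx → Γ ⁻ᶜ ⊢ M ⇔ N ∶ τ → A ⁻ ≡ τ →
                Γ ⊢ M ∶ A → Γ ⊢ N ∶ A → Γ ⊢ M ≐ N ∶ A
      sound-⇔ Γ (whˡ _ red d) p M N =
        ≐-trans (wh-sound Γ red M) (sound-⇔ Γ d p (wh-valid Γ red M) N)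
      sound-⇔ Γ (whʳ _ red d) p M N =
        ≐-trans (sound-⇔ Γ d p M (wh-valid Γ red N)) (≐-sym (wh-sound Γ red N))
      sound-⇔ Γ (struct _ d)  p M N = proj₁ (proj₂ (sound-↔ Γ d M N))
      sound-⇔ Γ (ext d)       p M N
        with _ , _ , refl ← ⇒-shape (obj-valid Γ M) p
        with refl ← p
        with A , _ ← Π-inv (obj-valid Γ M) =
        ext A M N (sound-⇔ (Γ ▸ A) d refl (eta-app M) (eta-app N))
      sound-⇔ Γ (newExt d)    p M N
        with _ , refl ← ⟨⟩ˢ-shape (obj-valid Γ M) p
        with refl ← p
        with i , _ ← New-inv (obj-valid Γ M) =
        newExt i (sound-⇔ (Γ # i) d refl (eta-conc M) (eta-conc N))

      sound-↔ : ∀ {Γ : Ctx n m} {M N A B τ} → ⊢ Γ ctx → Γ ⁻ᶜ ⊢ M ↔ N ∶ τ →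
                Γ ⊢ M ∶ A → Γ ⊢ N ∶ B → StructurallySound Γ M N A B τ
      sound-↔ Γ (var x) M N
        with _ , i , g ← var-inv M | _ , j , h ← var-inv N
        with refl ← ∋-unique i j =
        sound-≐ Γ (var i) (type-refl (ctx-lookup Γ i)) (∋-erase i x) g h
      sound-↔ Γ (con {A = A} c) M N
        with _ , i , g ← con-inv M | _ , j , h ← con-inv N
        with refl ← ∈-unique ⊢Σ i c | refl ← ∈-unique ⊢Σ j c =
        sound-≐ Γ (con i) (type-refl (ren-type ∙ (∈⇒type ⊢Σ i))) (renTy⁻ fromClosed A) g h
      sound-↔ {Γ = Γ₀} Γ (name a) M N
        with _ , i , g ← name-inv M | _ , j , h ← name-inv N
        with refl ← ∋ⁿ-unique i j =
        sound-≐ Γ (name i) (name (ctx-name Γ i)) (cong name (∋ⁿ-unique (∋ⁿ-erase i) a)) g h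
      sound-↔ Γ (app d₁ d₂) M N
        with _ , A₂ , M₁ , M₂ , g ← app-inv M | _ , B₂ , N₁ , N₂ , h ← app-inv N
        with f , e₁ , refl , _ ← sound-↔ Γ d₁ M₁ N₁
        with Π f₁ f₂ ← type-match f refl =
        -- The arguments are typed at two different domains. Their equality, obtained from the
        -- function parts, moves `N₂` to the left domain, where the two can be compared.
        let e₂ = sound-⇔ Γ d₂ refl M₂ (conv N₂ (≐-sym f₁))
            _ , A , _ = Π-inv (obj-valid Γ M₁)
        in sound-≐ Γ (app-cong e₁ e₂)
             -- Equal arguments are exchanged in the left codomain, and then the two codomains are
             -- compared at the right argument.
             (≐-trans (Functionality.fun-type (related-inst M₂ e₂) A)
               (TypedSub.sub-type≐ (typed-inst (conv N₂ (≐-sym f₁))) f₂))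
             (subTy⁻ _ A₂) g h
      sound-↔ Γ (conc {M = M₀} {N₀} {a} s d) M N
        with concInv {B = A} r p M' g ← conc-inv M refl
           | concInv r' q N' h ← conc-inv N refl
        -- Three restrictions by `a` meet: one from each typing, and one of the erased context from
        -- the algorithm. Once they coincide, injectivity of the embedding identifies the objects
        -- compared by the algorithm with the typed preimages.
        with refl ← restriction-unique r r'
        with refl ← restriction-unique (eraseʳ r) s
        with refl ← emb-erased-injective r p | refl ← emb-erased-injective r q
        with f , e , refl , _ ← sound-↔ (ctx-restrict Γ r) d M' N'
        with New f' ← type-match f refl =
        sound-≐ Γ
          (coe≐ (cong (λ ρ → renObj ρ M₀ ＠ a) (sym (emb-eraseʳ r)))
            (cong (λ ρ → renObj ρ N₀ ＠ a) (sym (emb-eraseʳ r))) refl (＠-cong r e))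
          (conc-type≐ r f')
          (trans (renTy⁻ (instName a) (renTy (liftⁿ (emb r)) A)) (renTy⁻ (liftⁿ (emb r)) A)) g h

theorem4p3 : (Σ : Sig) → ⊢ Σ sig →
    let open Judgments Σ
        open Algorithm Σ
    in
    {n m : ℕ} (Γ : Ctx n m) → ⊢ Γ ctx →
    (M N : Obj n m) (A B : Ty n m) (τ : STy) →
    ((Γ ⁻ᶜ ⊢ M ⇔ N ∶ A ⁻) → (Γ ⊢ M ∶ A) → (Γ ⊢ N ∶ A) →
      (Γ ⊢ M ≐ N ∶ A))
    ×
    ((Γ ⁻ᶜ ⊢ M ↔ N ∶ τ) → (Γ ⊢ M ∶ A) → (Γ ⊢ N ∶ B) →
      (Γ ⊢ᵗ A ≐ B ∶ type) × (Γ ⊢ M ≐ N ∶ A) × (A ⁻ ≡ τ) × (τ ≡ B ⁻))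
theorem4p3 Σ ⊢Σ Γ ⊢Γ M N A B τ = (λ d → sound-⇔ ⊢Γ d refl) , sound-↔ ⊢Γ
  where open Metatheory.Regularity Σ ⊢Σ
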